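{- For any ${\rm LP}^{\rm MLN}$ programs $\mathsf F$ and $\mathsf G$, program $\mathsf F$ is strongly equivalent to $\mathsf G$ if and only if there is a w-expression $e^{c_1+c_2\alpha}$ (with $c_1$ a real number and $c_2$ an integer) such that for every interpretation $X$: (1a) $\displaystyle\sum_{w:R\in\mathsf F,\ w\neq\alpha,\ X\not\models R}w\;=\;c_1+\sum_{w:R\in\mathsf G,\ w\neq\alpha,\ X\not\models R}w$; (1b) $|\{\alpha:R\in\mathsf F\mid X\not\models R\}|=c_2+|\{\alpha:R\in\mathsf G\mid X\not\models R\}|$; (2) $\{p'\rightarrow p\mid p\in{\bf p}\}$ entails $\Delta_{{\bf p}'}(\{\overline{\mathsf F}\}^{\rm ch})\leftrightarrow\Delta_{{\bf p}'}(\{\overline{\mathsf G}\}^{\rm ch})$ (in the sense of classical logic).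
   Context: Let ${\bf p}$ be the propositional signature and ${\bf p}'$ the set of new atoms $p'$, one for each $p\in{\bf p}$. Propositional formulas are built from atoms and $\bot$ using $\land,\lor,\rightarrow$, with $\neg F$ standing for $F\rightarrow\bot$ and $\top$ for $\bot\rightarrow\bot$. An interpretation is identified with the set of atoms (of ${\bf p}$) true in it; $X\models R$ is classical satisfaction. The reduct $F^X$ is obtained from $F$ by replacing every maximal subformula not (classically) satisfied by $X$ with $\bot$; for a set $\Gamma$ of formulas, $\Gamma^X=\{F^X\mid F\in\Gamma\}$. $X$ is a (standard) stable model of $\Gamma$ if $X$ is a minimal model (with respect to inclusion) of $\Gamma^X$. An ${\rm LP}^{\rm MLN}$ program is a finite set of weighted formulas $w:R$, where $R$ is a propositional formula over ${\bf p}$ and $w$ is a real number (soft rule) or the symbol $\alpha$ denoting infinite weight (hard rule). $\overline{\mathsf F}$ is the set of formulas obtained from $\mathsf F$ by dropping weights, and $\mathsf F_X$ is the set of those $w:R$ in $\mathsf F$ with $X\models R$. $X$ is a soft stable model of $\mathsf F$ if $X$ is a stable model of $\overline{\mathsf F_X}$; ${\rm SM}[\mathsf F]$ is the set of soft stable models of $\mathsf F$. $TW(\mathsf F)$ denotes the expression $\exp\big(\sum_{w:R\in\mathsf F}w\big)$. $W_{\mathsf F}(X)=TW(\mathsf F_X)$ if $X\in{\rm SM}[\mathsf F]$ and $0$ otherwise, and $P_{\mathsf F}(X)=\lim_{\alpha\to\infty}\frac{W_{\mathsf F}(X)}{\sum_{Y\in{\rm SM}[\mathsf F]}W_{\mathsf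 F}(Y)}$. $\mathsf F$ and $\mathsf G$ are strongly equivalent if, for any ${\rm LP}^{\rm MLN}$ program $\mathsf H$, $P_{\mathsf F\cup\mathsf H}(X)=P_{\mathsf G\cup\mathsf H}(X)$ for all interpretations $X$. A w-expression is an expression of the form $e^{c_1+c_2\alpha}$, where $c_1$ is a real number and $c_2$ is an integer. $\{F\}^{\rm ch}$ denotes $F\lor\neg F$, and $\{\Gamma\}^{\rm ch}=\{\{F\}^{\rm ch}\mid F\in\Gamma\}$ for a set $\Gamma$ of formulas. For a formula $F$ over ${\bf p}$, $\Delta_{{\bf p}'}(F)$ is defined recursively: $\Delta_{{\bf p}'}(p)=p'$ for atoms $p\in{\bf p}$; $\Delta_{{\bf p}'}(\bot)=\bot$; $\Delta_{{\bf p}'}(\neg F)=\neg F$; $\Delta_{{\bf p}'}(F\land G)=\Delta_{{\bf p}'}(F)\land\Delta_{{\bf p}'}(G)$; $\Delta_{{\bf p}'}(F\lor G)=\Delta_{{\bf p}'}(F)\lor\Delta_{{\bf p}'}(G)$; $\Delta_{{\bf p}'}(F\rightarrow G)=(\Delta_{{\bf p}'}(F)\rightarrow\Delta_{{\bf p}'}(G))\land(F\rightarrow G)$. Applied to a finite set of formulas, $\Delta_{{\bf p}'}$ is applied to the conjunction of its elements (the empty conjunction being $\top$).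
   Formalization: Programs are finite multisets and union adds multiplicities; with idempotent set union the claim fails for F = H = {1:p}, G = {1:p∧⊤}. Equality of atoms is assumed decidable, which is automatic classically. -}

module Defs where

open import Algebra.Core using (Op₁; Op₂)
open import Algebra.Structures using (IsCommutativeRing)
open import Data.Bool.Base using (Bool; true; false; T; not; _∧_; _∨_; if_then_else_)
open import Data.List.Base using (List; []; _∷_; _++_; map; foldr; filterᵇ)
open import Data.List.Membership.Setoid using () renaming (_∈_ to Member)
open import Data.List.Relation.Unary.All using (All)
open import Data.List.Relation.Unary.Unique.Setoid using (Unique)
open import Data.Nat.Base using (ℕ)
open import Data.Product.Base using (Σ; ∃; _×_; _,_; proj₂)
open import Data.Sum.Base using (_⊎_; inj₁; inj₂)
open import Function.Bundles using (_⇔_)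
open import Level using (0ℓ)
open import Relation.Binary.Core using (Rel)
open import Relation.Binary.PropositionalEquality using (_≡_; _≢_; _→-setoid_)
open import Relation.Binary.Structures using (IsDecTotalOrder)
open import Relation.Nullary.Decidable.Core using (Dec; yes; no)
open import Relation.Unary using (Pred; Satisfiable)
import Relation.Binary.Construct.NonStrictToStrict as ToStrict

-- The real numbers, axiomatised (classically) as a Dedekind-complete ordered
-- field, together with the exponential function.  These axioms determine the
-- structure up to unique isomorphism; in particular exp is the only function
-- on ℝ with exp (x + y) = exp x · exp y and exp x ≥ 1 + x.  As usual for a
-- total inverse, nothing is assumed about 0 ⁻¹.

record RealNumbers : Set₁ where
  infix  8 -_ _⁻¹
  infixl 7 _*_ _/_
  infixl 6 _+_ _-_
  infix  4 _≤_

  field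
    Carrier : Set
    _+_ _*_ : Op₂ Carrier
    -_ _⁻¹  : Op₁ Carrier
    0# 1#   : Carrier
    _≤_     : Rel Carrier 0ℓ

    isCommutativeRing : IsCommutativeRing _≡_ _+_ _*_ -_ 0# 1#
    0≢1               : 0# ≢ 1#
    ⁻¹-inverseʳ       : ∀ x → x ≢ 0# → x * x ⁻¹ ≡ 1#

    isDecTotalOrder   : IsDecTotalOrder _≡_ _≤_
    +-monoʳ-≤         : ∀ x {y z} → y ≤ z → x + y ≤ x + z
    *-nonneg          : ∀ {x y} → 0# ≤ x → 0# ≤ y → 0# ≤ x * y

  UpperBound : Pred Carrier 0ℓ → Pred Carrier 0ℓ
  UpperBound S b = ∀ x → S x → x ≤ b

  field
    supremum : (S : Pred Carrier 0ℓ) → Satisfiable S → Satisfiable (UpperBound S) →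
               ∃ λ s → UpperBound S s × (∀ b → UpperBound S b → s ≤ b)

    exp      : Op₁ Carrier
    exp-+    : ∀ x y → exp (x + y) ≡ exp x * exp y
    1+x≤exp  : ∀ x → 1# + x ≤ exp x

  open ToStrict _≡_ _≤_ public using (_<_)

  _-_ : Op₂ Carrier
  x - y = x + (- y)

  _/_ : Op₂ Carrier
  x / y = x * y ⁻¹

  ∑ : List Carrier → Carrier
  ∑ = foldr _+_ 0#

  Limit∞ : (Carrier → Carrier) → Carrier → Set
  Limit∞ f r = ∀ ε → 0# < ε → ∃ λ N → ∀ a → N ≤ a → r - ε < f a × f a < r + ε

infixr 7 _∧ᶠ_
infixr 6 _∨ᶠ_
infixr 5 _⇒ᶠ_

data Formula (A : Set) : Set where
  atom : A → Formula A
  ⊥ᶠ   : Formula A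
  _∧ᶠ_ _∨ᶠ_ _⇒ᶠ_ : (F G : Formula A) → Formula A

module _ {A : Set} where

  infix 4 _⇔ᶠ_
  infix 8 ¬ᶠ_

  ¬ᶠ_ : Formula A → Formula A
  ¬ᶠ F = F ⇒ᶠ ⊥ᶠ

  ⊤ᶠ : Formula A
  ⊤ᶠ = ⊥ᶠ ⇒ᶠ ⊥ᶠ

  _⇔ᶠ_ : (F G : Formula A) → Formula A
  F ⇔ᶠ G = (F ⇒ᶠ G) ∧ᶠ (G ⇒ᶠ F)

  ⋀ : List (Formula A) → Formula A
  ⋀ = foldr _∧ᶠ_ ⊤ᶠ

  choice : Formula A → Formula A
  choice F = F ∨ᶠ ¬ᶠ F

-- A set of atoms, given by its characteristic function.

Interpretation : Set → Set
Interpretation A = A → Bool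

module _ {A : Set} where

  infix 4 _⊆_ _⊨_

  _⊆_ : Rel (Interpretation A) 0ℓ
  Y ⊆ X = ∀ p → T (Y p) → T (X p)

  eval : Interpretation A → Formula A → Bool
  eval X (atom p) = X p
  eval X ⊥ᶠ       = false
  eval X (F ∧ᶠ G) = eval X F ∧ eval X G
  eval X (F ∨ᶠ G) = eval X F ∨ eval X G
  eval X (F ⇒ᶠ G) = not (eval X F) ∨ eval X G

  _⊨_ : Interpretation A → Formula A → Set
  X ⊨ F = T (eval X F)

  Entails : Pred (Formula A) 0ℓ → Formula A → Set
  Entails Γ F = ∀ I → (∀ G → Γ G → I ⊨ G) → I ⊨ F

  reduct reduct-parts : Interpretation A → Formula A → Formula A
  reduct X F = if eval X F then reduct-parts X F else ⊥ᶠ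

  reduct-parts X (atom p) = atom p
  reduct-parts X ⊥ᶠ       = ⊥ᶠ
  reduct-parts X (F ∧ᶠ G) = reduct X F ∧ᶠ reduct X G
  reduct-parts X (F ∨ᶠ G) = reduct X F ∨ᶠ reduct X G
  reduct-parts X (F ⇒ᶠ G) = reduct X F ⇒ᶠ reduct X G

  Models : Interpretation A → List (Formula A) → Set
  Models X Γ = All (X ⊨_) Γ

  StableModel : List (Formula A) → Interpretation A → Set
  StableModel Γ X = Models X Γˣ × (∀ Y → Models Y Γˣ → Y ⊆ X → X ⊆ Y)
    where Γˣ = map (reduct X) Γ

-- Formulas over 𝐩 ∪ 𝐩′: the atom p is inj₁ p and its copy p′ is inj₂ p.

module _ {A : Set} where

  ι : Formula A → Formula (A ⊎ A)
  ι (atom p) = atom (inj₁ p)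
  ι ⊥ᶠ       = ⊥ᶠ
  ι (F ∧ᶠ G) = ι F ∧ᶠ ι G
  ι (F ∨ᶠ G) = ι F ∨ᶠ ι G
  ι (F ⇒ᶠ G) = ι F ⇒ᶠ ι G

  -- ¬F abbreviates F → ⊥, so the clause for negation has to precede the
  -- general clause for implication.
  Δ : Formula A → Formula (A ⊎ A)
  Δ (atom p)  = atom (inj₂ p)
  Δ ⊥ᶠ        = ⊥ᶠ
  Δ (F ⇒ᶠ ⊥ᶠ) = ¬ᶠ ι F
  Δ (F ∧ᶠ G)  = Δ F ∧ᶠ Δ G
  Δ (F ∨ᶠ G)  = Δ F ∨ᶠ Δ G
  Δ (F ⇒ᶠ G)  = (Δ F ⇒ᶠ Δ G) ∧ᶠ (ι F ⇒ᶠ ι G)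

  Δ⋀ : List (Formula A) → Formula (A ⊎ A)
  Δ⋀ Γ = Δ (⋀ Γ)

  data Primed⇒Unprimed : Pred (Formula (A ⊎ A)) 0ℓ where
    p′⇒p : ∀ p → Primed⇒Unprimed (atom (inj₂ p) ⇒ᶠ atom (inj₁ p))

module LPMLN (ℝ : RealNumbers) where

  open RealNumbers ℝ

  data Weight : Set where
    soft : Carrier → Weight
    hard : Weight

  -- Programs are finite multisets of weighted formulas and union adds
  -- multiplicities.  With idempotent union the characterisation of strong
  -- equivalence would fail when H shares rules with only one of F and G: take
  -- F = H = {1 : p} and G = {1 : p ∧ ⊤}.
  Program : Set → Set
  Program A = List (Weight × Formula A)

  module _ {A : Set} where

    infixr 5 _∪_

    _∪_ : Op₂ (Program A)
    _∪_ = _++_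

    drop-weights : Program A → List (Formula A)
    drop-weights = map proj₂

    satisfied unsatisfied : Program A → Interpretation A → Program A
    satisfied   F X = filterᵇ (λ (_ , R) → eval X R) F
    unsatisfied F X = filterᵇ (λ (_ , R) → not (eval X R)) F

    soft-weights : Program A → List Carrier
    soft-weights []                 = []
    soft-weights ((soft w , _) ∷ F) = w ∷ soft-weights F
    soft-weights ((hard   , _) ∷ F) = soft-weights F

    hard-count : Program A → ℕ
    hard-count []                 = 0
    hard-count ((soft _ , _) ∷ F) = hard-count F
    hard-count ((hard   , _) ∷ F) = ℕ.suc (hard-count F)

    -- Expressions in the symbol α are functions of its value a.
    weight-at : Carrier → Weight → Carrier
    weight-at a (soft w) = w
    weight-at a hard     = a

    TW : Program A → Carrier → Carrier
    TW F a = exp (∑ (map (λ (w , _) → weight-at a w) F))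

    SM : Program A → Interpretation A → Set
    SM F X = StableModel (drop-weights (satisfied F X)) X

    W : (F : Program A) (X : Interpretation A) → Dec (SM F X) → Carrier → Carrier
    W F X (yes _) a = TW (satisfied F X) a
    W F X (no  _) a = 0#

    -- The list has no repetitions and its elements are exactly the soft stable
    -- models of F; interpretations are compared pointwise.
    EnumeratesSM : Program A → List (Interpretation A) → Set
    EnumeratesSM F L = Unique S L × (∀ Y → Member S Y L ⇔ SM F Y)
      where S = A →-setoid Bool

    -- r is the value of P_F(X).  In the denominator, W_F(Y) = TW(F_Y) since Y
    -- ranges over SM[F].  Classically there is always exactly one such r: SM[F]
    -- is finite and contains ∅.
    Probability : Program A → Interpretation A → Carrier → Set
    Probability F X r =
      Σ (Dec (SM F X)) λ d → Σ (List (Interpretation A)) λ L → EnumeratesSM F L ×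
      Limit∞ (λ a → W F X d a / ∑ (map (λ Y → TW (satisfied F Y) a) L)) r

    StronglyEquivalent : Rel (Program A) 0ℓ
    StronglyEquivalent F G =
      ∀ (H : Program A) X r → Probability (F ∪ H) X r ⇔ Probability (G ∪ H) X r

{-# OPTIONS --safe #-}
module Submission where

-- Satisfaction of the reduct R ^ X by Y ⊆ X is satisfaction of R by the
-- here-and-there interpretation (X , Y), and so is satisfaction of Δ R with 𝐩
-- read off X and 𝐩′ off Y.  Condition (2) thus says that the rules of F true in X
-- and those of G true in X have the same here-and-there models (X , Y).  Together
-- with (1) this makes F ∪ H and G ∪ H have the same soft stable models, and the
-- weights of these in F ∪ H and in G ∪ H proportional.
--
-- Conversely, let H contain w : ¬ R for every rule w : R of F, together with
-- rules of weight 0.  Then F ∪ H gives all its soft stable models the same weight,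
-- so that no limit has to be computed to know its probabilities.  If the rules of
-- weight 0 are p ∨ ¬ p for the relevant atoms p, every X is stable, and G ∪ H
-- weighs X by the exponential of the difference between the violated weights of F
-- and of G; equal probabilities then force this difference, which is affine in α,
-- to be constant.  If (X , Y) is a model for F but not for G, let H contain
-- the negated rules of G instead, and choose rules of weight 0 that leave Y as the
-- only possible witness against the stability of X: X has probability 0 for F ∪ H
-- and positive probability for G ∪ H.

open import Defs
open import Algebra.Bundles using (AbelianGroup; CommutativeRing)
open import Algebra.Core using (Op₁)
import Algebra.Properties.CommutativeSemigroup as CommutativeSemigroupProperties
import Algebra.Properties.Group as GroupProperties
import Algebra.Properties.Monoid.Mult as Mult
import Algebra.Properties.Ring as RingProperties
import Algebra.Solver.Ring.NaturalCoefficients.Default as SemiringSolver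
open import Data.Bool.Base using (Bool; true; false; T; not; _∧_; _∨_; if_then_else_)
open import Data.Bool.Properties using (T-∧; T-∨; T?; ∧-idem) renaming (_≟_ to _≟ᵇ_)
open import Data.Empty using (⊥)
open import Data.Integer.Base using (ℤ; +_) renaming (_+_ to _+ᶻ_; _-_ to _-ᶻ_)
import Data.Integer.Properties as ℤ
open import Data.List.Base using (List; []; _∷_; _++_; map; filter; filterᵇ; concatMap; deduplicate; cartesianProductWith)
open import Data.List.Membership.Propositional using (_∈_; find; lose)
open import Data.List.Membership.Propositional.Properties using (∈-++⁺ˡ; ∈-++⁺ʳ; ∈-cartesianProductWith⁺)
import Data.List.Membership.DecPropositional as DecMembership
import Data.List.Membership.Setoid as Membership
open import Data.List.Membership.Setoid.Properties using (∈-∃++; ∈-filter⁺; ∈-filter⁻; ∈-deduplicate⁺)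
open import Data.List.Properties using (filter-++)
import Data.List.Relation.Binary.Permutation.Setoid as Permutation
import Data.List.Relation.Binary.Permutation.Setoid.Properties as Permutationₚ
open import Data.List.Relation.Unary.All as All using (All; []; _∷_)
import Data.List.Relation.Unary.All.Properties as All
open import Data.List.Relation.Unary.AllPairs as AllPairs using ([]; _∷_)
open import Data.List.Relation.Unary.Any as Any using (Any; here; there)
import Data.List.Relation.Unary.Any.Properties as Any
open import Data.List.Relation.Unary.Unique.DecSetoid.Properties using (deduplicate-!)
open import Data.List.Relation.Unary.Unique.Setoid using (Unique)
open import Data.List.Relation.Unary.Unique.Setoid.Properties using (filter⁺)
open import Data.Nat.Base as ℕ using (ℕ; suc)
import Data.Nat.Properties as ℕ
open import Data.Product.Base using (∃; ∃₂; _×_; _,_; proj₁; proj₂)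
open import Data.Sum.Base using (_⊎_; inj₁; inj₂; [_,_]′)
open import Data.Unit.Base using (⊤; tt)
open import Function.Base using (_∘_; id)
open import Function.Bundles using (_⇔_; mk⇔; module Equivalence)
open import Level using (0ℓ)
open import Relation.Binary.Bundles using (Setoid; DecSetoid; DecTotalOrder)
open import Relation.Binary.Definitions using (DecidableEquality)
import Relation.Binary.Properties.DecTotalOrder as OrderProperties
open import Relation.Binary.PropositionalEquality using (_≡_; _≢_; _≗_; _→-setoid_; setoid;
  refl; sym; trans; cong; cong₂; subst; subst₂)
import Relation.Binary.Reasoning.PartialOrder as ≤-Reasoning
import Relation.Binary.Reasoning.Setoid as ≈-Reasoning
open import Relation.Nullary using (¬_; Dec; yes; no; does; contradiction)
open import Relation.Nullary.Decidable using (_→-dec_; ⌊_⌋; decidable-stable; fromWitness; map′; toWitness)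
open import Relation.Unary using (Decidable)

open Equivalence using (to; from)

-- Ordered-field arithmetic, the exponential, and asymptotic comparison of affine functions.

module RealProperties (ℝ : RealNumbers) where
  open RealNumbers ℝ

  commutativeRing : CommutativeRing 0ℓ 0ℓ
  commutativeRing = record { isCommutativeRing = isCommutativeRing }

  open CommutativeRing commutativeRing public
    using (+-congˡ; +-identityˡ; +-identityʳ; +-assoc; +-comm; *-assoc; *-comm;
           *-identityʳ; distribˡ; distribʳ; zeroˡ; zeroʳ;
           -‿inverseˡ; -‿inverseʳ; ring; +-monoid; +-isCommutativeMonoid; +-abelianGroup;
           commutativeSemiring)
  open RingProperties ring public using (-1*x≈-x; -‿involutive; +-cancelʳ)
  open Mult +-monoid public using (×-homo-+) renaming (_×_ to _·_)
  open SemiringSolver commutativeSemiring public using (solve; _:+_; _:*_; _:=_)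

  decTotalOrder : DecTotalOrder 0ℓ 0ℓ 0ℓ
  decTotalOrder = record { isDecTotalOrder = isDecTotalOrder }

  open DecTotalOrder decTotalOrder public using (_≤?_; total; antisym; poset)
    renaming (refl to ≤-refl; reflexive to ≤-reflexive; trans to ≤-trans)
  open OrderProperties decTotalOrder public using (<⇒≱; ≰⇒>; ≤∧≉⇒<)
  open ≤-Reasoning poset public

  <⇒≤ : ∀ {x y} → x < y → x ≤ y
  <⇒≤ = proj₁

  +-monoˡ-≤ : ∀ x {y z} → y ≤ z → y + x ≤ z + x
  +-monoˡ-≤ x {y} {z} y≤z = subst₂ _≤_ (+-comm x y) (+-comm x z) (+-monoʳ-≤ x y≤z)

  x+y-x : ∀ x y → x + (y - x) ≡ y
  x+y-x x y = begin-equality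
    x + (y - x)    ≡⟨ +-congˡ (+-comm y (- x)) ⟩
    x + (- x + y)  ≡⟨ +-assoc x (- x) y ⟨
    x - x + y      ≡⟨ cong (_+ y) (-‿inverseʳ x) ⟩
    0# + y         ≡⟨ +-identityˡ y ⟩
    y              ∎

  +-cancelˡ-≤ : ∀ x {y z} → x + y ≤ x + z → y ≤ z
  +-cancelˡ-≤ x {y} {z} le = subst₂ _≤_ (-x+x+y y) (-x+x+y z) (+-monoʳ-≤ (- x) le)
    where
    -x+x+y : ∀ y → - x + (x + y) ≡ y
    -x+x+y y = trans (sym (+-assoc (- x) x y)) (trans (cong (_+ y) (-‿inverseˡ x)) (+-identityˡ y))

  +-monoʳ-< : ∀ x {y z} → y < z → x + y < x + z
  +-monoʳ-< x y<z = ≰⇒> (<⇒≱ y<z ∘ +-cancelˡ-≤ x)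

  +-monoˡ-< : ∀ x {y z} → y < z → y + x < z + x
  +-monoˡ-< x {y} {z} y<z = subst₂ _<_ (+-comm x y) (+-comm x z) (+-monoʳ-< x y<z)

  +-cancelˡ-< : ∀ x {y z} → x + y < x + z → y < z
  +-cancelˡ-< x lt = ≰⇒> (<⇒≱ lt ∘ +-monoʳ-≤ x)

  *-monoʳ-≤ : ∀ {x y z} → 0# ≤ x → y ≤ z → x * y ≤ x * z
  *-monoʳ-≤ {x} {y} {z} 0≤x y≤z = begin
    x * y                ≡⟨ +-identityʳ (x * y) ⟨
    x * y + 0#           ≤⟨ +-monoʳ-≤ (x * y) (*-nonneg 0≤x 0≤z-y) ⟩
    x * y + x * (z - y)  ≡⟨ distribˡ x y (z - y) ⟨
    x * (y + (z - y))    ≡⟨ cong (x *_) (x+y-x y z) ⟩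
    x * z                ∎
    where
    0≤z-y : 0# ≤ z - y
    0≤z-y = +-cancelˡ-≤ y (subst₂ _≤_ (sym (+-identityʳ y)) (sym (x+y-x y z)) y≤z)

  *-monoˡ-≤ : ∀ {x y z} → 0# ≤ x → y ≤ z → y * x ≤ z * x
  *-monoˡ-≤ {x} {y} {z} 0≤x y≤z = subst₂ _≤_ (*-comm x y) (*-comm x z) (*-monoʳ-≤ 0≤x y≤z)

  0<1 : 0# < 1#
  0<1 = ≤∧≉⇒< 0≤1 0≢1
    where
    0≤1 : 0# ≤ 1#
    0≤1 with total 0# 1#
    ... | inj₁ 0≤1 = 0≤1
    ... | inj₂ 1≤0 = subst (0# ≤_) (trans (-1*x≈-x (- 1#)) (-‿involutive 1#)) (*-nonneg 0≤-1 0≤-1)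
      where
      0≤-1 : 0# ≤ - 1#
      0≤-1 = +-cancelˡ-≤ 1# (subst₂ _≤_ (sym (+-identityʳ 1#)) (sym (-‿inverseʳ 1#)) 1≤0)

  pos⇒≢0 : ∀ {x} → 0# < x → x ≢ 0#
  pos⇒≢0 0<x x≡0 = proj₂ 0<x (sym x≡0)

  ⁻¹-pos : ∀ {x} → 0# < x → 0# < x ⁻¹
  ⁻¹-pos {x} 0<x = ≰⇒> λ x⁻¹≤0 → <⇒≱ 0<1
    (subst₂ _≤_ (⁻¹-inverseʳ x (pos⇒≢0 0<x)) (zeroʳ x) (*-monoʳ-≤ (<⇒≤ 0<x) x⁻¹≤0))

  *-cancelʳ : ∀ {x y z} → 0# < z → x * z ≡ y * z → x ≡ y
  *-cancelʳ {x} {y} {z} 0<z xz≡yz = begin-equality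
    x                ≡⟨ xz/z x ⟨
    x * z * z ⁻¹     ≡⟨ cong (_* z ⁻¹) xz≡yz ⟩
    y * z * z ⁻¹     ≡⟨ xz/z y ⟩
    y                ∎
    where
    xz/z : ∀ x → x * z * z ⁻¹ ≡ x
    xz/z x = trans (*-assoc x z (z ⁻¹))
      (trans (cong (x *_) (⁻¹-inverseʳ z (pos⇒≢0 0<z))) (*-identityʳ x))

  *-pos : ∀ {x y} → 0# < x → 0# < y → 0# < x * y
  *-pos {x} {y} 0<x 0<y = ≤∧≉⇒< (*-nonneg (<⇒≤ 0<x) (<⇒≤ 0<y))
    λ 0≡xy → proj₂ 0<x (*-cancelʳ 0<y (trans (zeroˡ y) 0≡xy))

  +-pos-nonneg : ∀ {x y} → 0# < x → 0# ≤ y → 0# < x + y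
  +-pos-nonneg {x} {y} 0<x 0≤y = begin-strict
    0#      <⟨ 0<x ⟩
    x       ≡⟨ +-identityʳ x ⟨
    x + 0#  ≤⟨ +-monoʳ-≤ x 0≤y ⟩
    x + y   ∎

  *-cancelʳ-≤ : ∀ {x y z} → 0# < z → x * z ≤ y * z → x ≤ y
  *-cancelʳ-≤ {x} {y} {z} 0<z le with x ≤? y
  ... | yes x≤y = x≤y
  ... | no  x≰y = contradiction
    (*-cancelʳ 0<z (antisym le (*-monoˡ-≤ (<⇒≤ 0<z) (<⇒≤ (≰⇒> x≰y)))))
    (proj₂ (≰⇒> x≰y) ∘ sym)

  *-monoˡ-< : ∀ {x y z} → 0# < x → y < z → y * x < z * x
  *-monoˡ-< 0<x y<z = ≰⇒> (<⇒≱ y<z ∘ *-cancelʳ-≤ 0<x)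

  cross-multiply : ∀ {w x y z} → 0# < x → 0# < z → w * z ≡ y * x → w / x ≡ y / z
  cross-multiply {w} {x} {y} {z} 0<x 0<z wz≡yx = *-cancelʳ (*-pos 0<x 0<z) (begin-equality
    w * x ⁻¹ * (x * z)    ≡⟨ lem w (x ⁻¹) x z ⟩
    x * x ⁻¹ * (w * z)    ≡⟨ cong₂ _*_ (⁻¹-inverseʳ x (pos⇒≢0 0<x)) wz≡yx ⟩
    1# * (y * x)          ≡⟨ cong (_* (y * x)) (⁻¹-inverseʳ z (pos⇒≢0 0<z)) ⟨
    z * z ⁻¹ * (y * x)    ≡⟨ lem y (z ⁻¹) z x ⟨
    y * z ⁻¹ * (z * x)    ≡⟨ cong (y * z ⁻¹ *_) (*-comm z x) ⟩
    y * z ⁻¹ * (x * z)    ∎)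
    where
    lem : ∀ a b c d → a * b * (c * d) ≡ c * b * (a * d)
    lem = solve 4 (λ a b c d → a :* b :* (c :* d) := c :* b :* (a :* d)) refl

  upper-bound : ∀ x y → ∃ λ z → x ≤ z × y ≤ z
  upper-bound x y with total x y
  ... | inj₁ x≤y = y , x≤y , ≤-refl
  ... | inj₂ y≤x = x , ≤-refl , y≤x

  ·-nonneg : ∀ n {x} → 0# ≤ x → 0# ≤ n · x
  ·-nonneg 0       0≤x = ≤-refl
  ·-nonneg (suc n) {x} 0≤x = ≤-trans 0≤x
    (subst (_≤ x + n · x) (+-identityʳ x) (+-monoʳ-≤ x (·-nonneg n 0≤x)))

  -- For `x` at least 0 the bound `1+x≤exp` suffices. For `x` at most 0 it makes `exp (- x)`
  -- nonnegative, and `exp (- x) * exp x` is the positive number `exp 0#`.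
  exp-pos : ∀ x → 0# < exp x
  exp-pos x with total 0# x
  ... | inj₁ 0≤x = begin-strict 0# <⟨ +-pos-nonneg 0<1 0≤x ⟩ 1# + x ≤⟨ 1+x≤exp x ⟩ exp x ∎
  ... | inj₂ x≤0 = ≰⇒> λ exp≤0 → <⇒≱ 0<exp0 (begin
    exp 0#             ≡⟨ cong exp (-‿inverseˡ x) ⟨
    exp (- x + x)      ≡⟨ exp-+ (- x) x ⟩
    exp (- x) * exp x  ≤⟨ *-monoʳ-≤ 0≤exp-x exp≤0 ⟩
    exp (- x) * 0#     ≡⟨ zeroʳ _ ⟩
    0#                 ∎)
    where
    0<exp0 : 0# < exp 0#
    0<exp0 = begin-strict 0# <⟨ +-pos-nonneg 0<1 ≤-refl ⟩ 1# + 0# ≤⟨ 1+x≤exp 0# ⟩ exp 0# ∎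
    0≤-x : 0# ≤ - x
    0≤-x = +-cancelˡ-≤ x (subst₂ _≤_ (sym (+-identityʳ x)) (sym (-‿inverseʳ x)) x≤0)
    0≤exp-x : 0# ≤ exp (- x)
    0≤exp-x = begin 0# ≤⟨ <⇒≤ (+-pos-nonneg 0<1 0≤-x) ⟩ 1# - x ≤⟨ 1+x≤exp (- x) ⟩ exp (- x) ∎

  -- Here `exp y` is `exp x * exp (y - x)`, and the second factor is at least `1# + (y - x)`.
  exp-growth : ∀ {x y ε} → x + ε ≤ y → exp x * (1# + ε) ≤ exp y
  exp-growth {x} {y} {ε} x+ε≤y = begin
    exp x * (1# + ε)        ≤⟨ *-monoʳ-≤ (<⇒≤ (exp-pos x)) (+-monoʳ-≤ 1# ε≤y-x) ⟩
    exp x * (1# + (y - x))  ≤⟨ *-monoʳ-≤ (<⇒≤ (exp-pos x)) (1+x≤exp (y - x)) ⟩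
    exp x * exp (y - x)     ≡⟨ exp-+ x (y - x) ⟨
    exp (x + (y - x))       ≡⟨ cong exp (x+y-x x y) ⟩
    exp y                   ∎
    where
    ε≤y-x : ε ≤ y - x
    ε≤y-x = +-cancelˡ-≤ x (subst (x + ε ≤_) (sym (x+y-x x y)) x+ε≤y)

  -- lim sup (p - q) ≤ 0 at infinity.
  _≲_ : (Carrier → Carrier) → (Carrier → Carrier) → Set
  p ≲ q = ∀ ε → 0# < ε → ∃ λ N → ∀ a → N ≤ a → p a < q a + ε

  x-y<z⇒x<z+y : ∀ {x y z} → x - y < z → x < z + y
  x-y<z⇒x<z+y {x} {y} {z} lt = subst₂ _<_ (trans (+-comm _ y) (x+y-x y x)) refl (+-monoˡ-< y lt)

  -- If p a ≥ q a + ε then exp (p a) ≥ (1 + ε) exp (q a); but both quotients are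
  -- within η of r > 0, which is impossible once η (2 + ε) = r ε.
  equal-limits⇒≲ : ∀ {p q s : Op₁ Carrier} {r} → 0# < r → (∀ a → 0# < s a) →
                   Limit∞ (λ a → exp (p a) / s a) r →
                   Limit∞ (λ a → exp (q a) / s a) r → p ≲ q
  equal-limits⇒≲ {p} {q} {s} {r} 0<r 0<s p-lim q-lim ε 0<ε = N , below
    where
    two+ε = 1# + (1# + ε)
    0<two+ε : 0# < two+ε
    0<two+ε = +-pos-nonneg 0<1 (<⇒≤ (+-pos-nonneg 0<1 (<⇒≤ 0<ε)))
    η = r * ε / two+ε
    0<η : 0# < η
    0<η = *-pos (*-pos 0<r 0<ε) (⁻¹-pos 0<two+ε)
    ηtwo+ε : η * two+ε ≡ r * ε
    ηtwo+ε = trans (*-assoc _ _ _) (trans (cong (r * ε *_)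
      (trans (*-comm _ _) (⁻¹-inverseʳ two+ε (pos⇒≢0 0<two+ε)))) (*-identityʳ _))
    N₁ = proj₁ (p-lim η 0<η)
    N₂ = proj₁ (q-lim η 0<η)
    N = proj₁ (upper-bound N₁ N₂)
    below : ∀ a → N ≤ a → p a < q a + ε
    -- With `f` and `g` the two quotients at `a`, using `r < g + η` twice and `f < r + η` once gives
    -- `g + r * ε < g + η * two+ε`, whose sides are equal by the choice of `η`.
    below a N≤a = ≰⇒> λ q+ε≤p → <⇒≱ (begin-strict
      g + r * ε              <⟨ +-monoʳ-< g (*-monoˡ-< 0<ε r<g+η) ⟩
      g + (g + η) * ε        ≡⟨ lem₁ g η ε ⟩
      (g + g * ε) + η * ε    ≤⟨ +-monoˡ-≤ (η * ε) (g+gε≤f q+ε≤p) ⟩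
      f + η * ε              <⟨ +-monoˡ-< (η * ε) f<r+η ⟩
      (r + η) + η * ε        <⟨ +-monoˡ-< (η * ε) (+-monoˡ-< η r<g+η) ⟩
      (g + η + η) + η * ε    ≡⟨ cong (λ x → g + x + x + η * ε) (*-identityʳ η) ⟨
      (g + η * 1# + η * 1#) + η * ε  ≡⟨ lem₂ g η 1# ε ⟩
      g + η * two+ε          ∎)
      (≤-reflexive (+-congˡ ηtwo+ε))
      where
      f = exp (p a) / s a
      g = exp (q a) / s a
      f<r+η : f < r + η
      f<r+η = proj₂ (proj₂ (p-lim η 0<η) a (≤-trans (proj₁ (proj₂ (upper-bound N₁ N₂))) N≤a))
      r<g+η : r < g + η
      r<g+η = x-y<z⇒x<z+y
        (proj₁ (proj₂ (q-lim η 0<η) a (≤-trans (proj₂ (proj₂ (upper-bound N₁ N₂))) N≤a)))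
      lem₁ : ∀ g η ε → g + (g + η) * ε ≡ (g + g * ε) + η * ε
      lem₁ = solve 3 (λ g η ε → g :+ (g :+ η) :* ε := (g :+ g :* ε) :+ η :* ε) refl
      lem₂ : ∀ g η o ε → (g + η * o + η * o) + η * ε ≡ g + η * (o + (o + ε))
      lem₂ = solve 4 (λ g η o ε → (g :+ η :* o :+ η :* o) :+ η :* ε := g :+ η :* (o :+ (o :+ ε))) refl
      lem₃ : ∀ x y z → x * y * z ≡ x * z * y
      lem₃ = solve 3 (λ x y z → x :* y :* z := x :* z :* y) refl
      g+gε≤f : q a + ε ≤ p a → g + g * ε ≤ f
      g+gε≤f q+ε≤p = begin
        g + g * ε                          ≡⟨ cong (_+ g * ε) (*-identityʳ g) ⟨
        g * 1# + g * ε                     ≡⟨ distribˡ g 1# ε ⟨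
        exp (q a) * s a ⁻¹ * (1# + ε)      ≡⟨ lem₃ (exp (q a)) (s a ⁻¹) (1# + ε) ⟩
        exp (q a) * (1# + ε) * s a ⁻¹      ≤⟨ *-monoˡ-≤ (<⇒≤ (⁻¹-pos (0<s a))) (exp-growth q+ε≤p) ⟩
        f                                  ∎

  -- If `m` is `n + 1 + k`, then `x + m · a` reaches `y + n · a + 1#` as soon as `a` is at least
  -- both 0 and `y + 1# - x`. This contradicts `_≲_` at tolerance 1.
  affine-≲⇒slope-≤ : ∀ {x y} m n → (λ a → x + m · a) ≲ (λ a → y + n · a) → m ℕ.≤ n
  affine-≲⇒slope-≤ {x} {y} m n le with m ℕ.≤? n
  ... | yes m≤n = m≤n
  ... | no  m≰n with ℕ.m≤n⇒∃[o]m+o≡n (ℕ.≰⇒> m≰n) | le 1# 0<1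
  ... | k , refl | N , below = contradiction (begin
    y + n · a + 1#                   ≡⟨ lem₁ y (n · a) 1# ⟩
    n · a + (y + 1#)                 ≡⟨ +-congˡ (x+y-x x (y + 1#)) ⟨
    n · a + (x + (y + 1# - x))       ≤⟨ +-monoʳ-≤ (n · a) (+-monoʳ-≤ x c≤a) ⟩
    n · a + (x + a)                  ≡⟨ +-identityʳ _ ⟨
    n · a + (x + a) + 0#             ≤⟨ +-monoʳ-≤ _ (·-nonneg k 0≤a) ⟩
    n · a + (x + a) + k · a          ≡⟨ lem₂ x a (n · a) (k · a) ⟩
    x + (a + (n · a + k · a))        ≡⟨ cong (λ z → x + (a + z)) (×-homo-+ a n k) ⟨
    x + (a + (n ℕ.+ k) · a)          ∎) (<⇒≱ (below a N≤a))
    where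
    lem₁ : ∀ y na o → y + na + o ≡ na + (y + o)
    lem₁ = solve 3 (λ y na o → y :+ na :+ o := na :+ (y :+ o)) refl
    lem₂ : ∀ x a na ka → na + (x + a) + ka ≡ x + (a + (na + ka))
    lem₂ = solve 4 (λ x a na ka → na :+ (x :+ a) :+ ka := x :+ (a :+ (na :+ ka))) refl
    c = y + 1# - x
    b = proj₁ (upper-bound 0# c)
    a = proj₁ (upper-bound N b)
    N≤a : N ≤ a
    N≤a = proj₁ (proj₂ (upper-bound N b))
    b≤a : b ≤ a
    b≤a = proj₂ (proj₂ (upper-bound N b))
    0≤a : 0# ≤ a
    0≤a = ≤-trans (proj₁ (proj₂ (upper-bound 0# c))) b≤a
    c≤a : c ≤ a
    c≤a = ≤-trans (proj₂ (proj₂ (upper-bound 0# c))) b≤a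

  -- If `y < x`, the tolerance `x - y` would yield `x + f N < x + f N`.
  +-≲-cancelʳ : ∀ {x y} (f : Carrier → Carrier) → (λ a → x + f a) ≲ (λ a → y + f a) → x ≤ y
  +-≲-cancelʳ {x} {y} f le with x ≤? y
  ... | yes x≤y = x≤y
  ... | no  x≰y with le (x - y) 0<x-y
    where
    0<x-y : 0# < x - y
    0<x-y = +-cancelˡ-< y (subst₂ _<_ (sym (+-identityʳ y)) (sym (x+y-x y x)) (≰⇒> x≰y))
  ... | N , below = contradiction (≤-reflexive (begin-equality
    y + f N + (x - y)    ≡⟨ solve 3 (λ y t d → y :+ t :+ d := y :+ d :+ t) refl y (f N) (x - y) ⟩
    y + (x - y) + f N    ≡⟨ cong (_+ f N) (x+y-x y x) ⟩
    x + f N              ∎)) (<⇒≱ (below N ≤-refl))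

  -- The slopes are compared first; once they coincide, the linear terms cancel and only the
  -- constants are left.
  affine-≲-antisym : ∀ {x y} m n →
                     (λ a → x + m · a) ≲ (λ a → y + n · a) →
                     (λ a → y + n · a) ≲ (λ a → x + m · a) →
                     x ≡ y × m ≡ n
  affine-≲-antisym m n le ge
    with refl ← ℕ.≤-antisym (affine-≲⇒slope-≤ m n le) (affine-≲⇒slope-≤ n m ge) =
    antisym (+-≲-cancelʳ (m ·_) le) (+-≲-cancelʳ (m ·_) ge) , refl

-- Boolean satisfaction, here-and-there logic, reducts and `Δ`.

T-ext : ∀ {b c} → (T b → T c) → (T c → T b) → b ≡ c
T-ext {false} {false} _ _ = refl
T-ext {false} {true}  _ g with () ← g tt
T-ext {true}  {false} f _ with () ← f tt
T-ext {true}  {true}  _ _ = refl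

T-⇒ : ∀ {b c} → T (not b ∨ c) ⇔ (T b → T c)
T-⇒ {false} = mk⇔ (λ _ ()) (λ _ → tt)
T-⇒ {true}  = mk⇔ (λ c _ → c) (λ f → f tt)

module _ {A : Set} where

  atoms : Formula A → List A
  atoms (atom p) = p ∷ []
  atoms ⊥ᶠ       = []
  atoms (F ∧ᶠ G) = atoms F ++ atoms G
  atoms (F ∨ᶠ G) = atoms F ++ atoms G
  atoms (F ⇒ᶠ G) = atoms F ++ atoms G

  Agree : List A → Interpretation A → Interpretation A → Set
  Agree V X Y = ∀ {p} → p ∈ V → X p ≡ Y p

  eval-cong : ∀ {X X′} R → Agree (atoms R) X X′ → eval X R ≡ eval X′ R
  eval-cong (atom p) eq = eq (here refl)
  eval-cong ⊥ᶠ       eq = refl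
  eval-cong (F ∧ᶠ G) eq = cong₂ _∧_
    (eval-cong F (eq ∘ ∈-++⁺ˡ)) (eval-cong G (eq ∘ ∈-++⁺ʳ (atoms F)))
  eval-cong (F ∨ᶠ G) eq = cong₂ _∨_
    (eval-cong F (eq ∘ ∈-++⁺ˡ)) (eval-cong G (eq ∘ ∈-++⁺ʳ (atoms F)))
  eval-cong (F ⇒ᶠ G) eq = cong₂ (λ b c → not b ∨ c)
    (eval-cong F (eq ∘ ∈-++⁺ˡ)) (eval-cong G (eq ∘ ∈-++⁺ʳ (atoms F)))

  -- Satisfaction in the logic of here-and-there, X being the "there" world and
  -- Y the "here" world.
  ht : Interpretation A → Interpretation A → Formula A → Bool
  ht X Y (atom p) = X p ∧ Y p
  ht X Y ⊥ᶠ       = false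
  ht X Y (F ∧ᶠ G) = ht X Y F ∧ ht X Y G
  ht X Y (F ∨ᶠ G) = ht X Y F ∨ ht X Y G
  ht X Y (F ⇒ᶠ G) = (not (ht X Y F) ∨ ht X Y G) ∧ eval X (F ⇒ᶠ G)

  ht-cong : ∀ {X X′ Y Y′} R → Agree (atoms R) X X′ → Agree (atoms R) Y Y′ → ht X Y R ≡ ht X′ Y′ R
  ht-cong (atom p) eq eq′ = cong₂ _∧_ (eq (here refl)) (eq′ (here refl))
  ht-cong ⊥ᶠ       eq eq′ = refl
  ht-cong (F ∧ᶠ G) eq eq′ = cong₂ _∧_
    (ht-cong F (eq ∘ ∈-++⁺ˡ) (eq′ ∘ ∈-++⁺ˡ))
    (ht-cong G (eq ∘ ∈-++⁺ʳ (atoms F)) (eq′ ∘ ∈-++⁺ʳ (atoms F)))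
  ht-cong (F ∨ᶠ G) eq eq′ = cong₂ _∨_
    (ht-cong F (eq ∘ ∈-++⁺ˡ) (eq′ ∘ ∈-++⁺ˡ))
    (ht-cong G (eq ∘ ∈-++⁺ʳ (atoms F)) (eq′ ∘ ∈-++⁺ʳ (atoms F)))
  ht-cong (F ⇒ᶠ G) eq eq′ = cong₂ _∧_ (cong₂ (λ b c → not b ∨ c)
    (ht-cong F (eq ∘ ∈-++⁺ˡ) (eq′ ∘ ∈-++⁺ˡ))
    (ht-cong G (eq ∘ ∈-++⁺ʳ (atoms F)) (eq′ ∘ ∈-++⁺ʳ (atoms F))))
    (eval-cong (F ⇒ᶠ G) eq)

  module _ (X : Interpretation A) where

    ht-diagonal : ∀ R → ht X X R ≡ eval X R
    ht-diagonal (atom p) = ∧-idem (X p)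
    ht-diagonal ⊥ᶠ       = refl
    ht-diagonal (F ∧ᶠ G) = cong₂ _∧_ (ht-diagonal F) (ht-diagonal G)
    ht-diagonal (F ∨ᶠ G) = cong₂ _∨_ (ht-diagonal F) (ht-diagonal G)
    ht-diagonal (F ⇒ᶠ G) = trans
      (cong (_∧ eval X (F ⇒ᶠ G)) (cong₂ (λ b c → not b ∨ c) (ht-diagonal F) (ht-diagonal G)))
      (∧-idem (eval X (F ⇒ᶠ G)))

    module _ (Y : Interpretation A) where

      -- Persistence: `ht` carries classical truth in `X` along, at atoms through the conjunct `X p`
      -- and at implications through the second conjunct.
      ht⇒eval : ∀ R → T (ht X Y R) → X ⊨ R
      ht⇒eval (atom p) h = proj₁ (to T-∧ h)
      ht⇒eval (F ∧ᶠ G) h = let f , g = to (T-∧ {ht X Y F}) h in from T-∧ (ht⇒eval F f , ht⇒eval G g)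
      ht⇒eval (F ∨ᶠ G) h = from T-∨ ([ inj₁ ∘ ht⇒eval F , inj₂ ∘ ht⇒eval G ]′ (to (T-∨ {ht X Y F}) h))
      ht⇒eval (F ⇒ᶠ G) h = proj₂ (to (T-∧ {not (ht X Y F) ∨ ht X Y G}) h)

      -- By persistence, a formula false in `X` cannot hold at `(X , Y)`, so negations are decided
      -- by `X` alone. This is what lets `Δ` leave `¬ᶠ F` unprimed, and what later allows negated
      -- rules to be added without affecting stability.
      ht-¬ : ∀ R → ht X Y (¬ᶠ R) ≡ eval X (¬ᶠ R)
      ht-¬ R = T-ext (ht⇒eval (¬ᶠ R)) λ ¬R → from (T-∧ {not (ht X Y R) ∨ false})
        (from (T-⇒ {ht X Y R}) (to (T-⇒ {eval X R}) ¬R ∘ ht⇒eval R) , ¬R)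

      -- A subformula false in `X` becomes `⊥ᶠ`, and there `ht` fails too, by persistence. At a
      -- subformula true in `X` both sides recurse alike, its truth supplying the extra conjuncts of
      -- `ht`.
      eval-reduct : ∀ R → eval Y (reduct X R) ≡ ht X Y R
      eval-reduct-parts : ∀ R → X ⊨ R → eval Y (reduct-parts X R) ≡ ht X Y R

      eval-reduct R with eval X R in eq
      ... | true  = eval-reduct-parts R (subst T (sym eq) tt)
      ... | false = T-ext (λ ()) (subst T eq ∘ ht⇒eval R)

      eval-reduct-parts (atom p) x = T-ext (λ y → from T-∧ (x , y)) (proj₂ ∘ to (T-∧ {X p}))
      eval-reduct-parts (F ∧ᶠ G) _ = cong₂ _∧_ (eval-reduct F) (eval-reduct G)
      eval-reduct-parts (F ∨ᶠ G) _ = cong₂ _∨_ (eval-reduct F) (eval-reduct G)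
      eval-reduct-parts (F ⇒ᶠ G) x = T-ext
        (λ h → from (T-∧ {not (ht X Y F) ∨ ht X Y G}) (subst T eq h , x))
        (λ h → subst T (sym eq) (proj₁ (to (T-∧ {not (ht X Y F) ∨ ht X Y G}) h)))
        where
        eq : eval Y (reduct X F ⇒ᶠ reduct X G) ≡ not (ht X Y F) ∨ ht X Y G
        eq = cong₂ (λ b c → not b ∨ c) (eval-reduct F) (eval-reduct G)

  module _ (I : Interpretation (A ⊎ A)) where

    private
      X Y : Interpretation A
      X = I ∘ inj₁
      Y = I ∘ inj₂

    eval-ι : ∀ R → eval I (ι R) ≡ eval X R
    eval-ι (atom p) = refl
    eval-ι ⊥ᶠ       = refl
    eval-ι (F ∧ᶠ G) = cong₂ _∧_ (eval-ι F) (eval-ι G)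
    eval-ι (F ∨ᶠ G) = cong₂ _∨_ (eval-ι F) (eval-ι G)
    eval-ι (F ⇒ᶠ G) = cong₂ (λ b c → not b ∨ c) (eval-ι F) (eval-ι G)

    -- The inclusion reconciles the atoms: `Δ` reads `p` as `Y p`, while `ht` reads it as
    -- `X p ∧ Y p`.
    eval-Δ : Y ⊆ X → ∀ R → eval I (Δ R) ≡ ht X Y R
    eval-Δ Y⊆X = go
      where
      go : ∀ R → eval I (Δ R) ≡ ht X Y R
      implication : ∀ F G → eval I ((Δ F ⇒ᶠ Δ G) ∧ᶠ (ι F ⇒ᶠ ι G)) ≡ ht X Y (F ⇒ᶠ G)

      go (atom p)          = T-ext (λ y → from T-∧ (Y⊆X p y , y)) (proj₂ ∘ to (T-∧ {X p}))
      go ⊥ᶠ                = refl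
      go (F ∧ᶠ G)          = cong₂ _∧_ (go F) (go G)
      go (F ∨ᶠ G)          = cong₂ _∨_ (go F) (go G)
      -- `Δ` tests for negation before general implication, so it reduces only once the head
      -- constructor of the conclusion is known.
      go (F ⇒ᶠ ⊥ᶠ)         = trans (eval-ι (¬ᶠ F)) (sym (ht-¬ X Y F))
      go (F ⇒ᶠ G@(atom _)) = implication F G
      go (F ⇒ᶠ G@(_ ∧ᶠ _)) = implication F G
      go (F ⇒ᶠ G@(_ ∨ᶠ _)) = implication F G
      go (F ⇒ᶠ G@(_ ⇒ᶠ _)) = implication F G

      implication F G = cong₂ _∧_ (cong₂ (λ b c → not b ∨ c) (go F) (go G)) (eval-ι (F ⇒ᶠ G))

  -- By `ht-¬` the disjunct `¬ᶠ R` just says that `R` is false in `X`. Choice thus frees a rule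
  -- violated by `X` and enforces one that `X` satisfies, which is how soft rules enter the reduct.
  ht-choice : ∀ {X Y} R → T (ht X Y (choice R)) ⇔ (X ⊨ R → T (ht X Y R))
  ht-choice {X} {Y} R = mk⇔
    (λ h x → [ id , (λ n → contradiction x (¬x n)) ]′ (to (T-∨ {ht X Y R}) h))
    (λ f → from (T-∨ {ht X Y R}) (by-cases f))
    where
    ¬x : T (ht X Y (¬ᶠ R)) → ¬ X ⊨ R
    ¬x n = to (T-⇒ {eval X R}) (subst T (ht-¬ X Y R) n)
    by-cases : (X ⊨ R → T (ht X Y R)) → T (ht X Y R) ⊎ T (ht X Y (¬ᶠ R))
    by-cases f with T? (eval X R)
    ... | yes x = inj₁ (f x)
    ... | no ¬x = inj₂ (subst T (sym (ht-¬ X Y R)) (from (T-⇒ {eval X R}) ¬x))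

  ht-⋀ : ∀ {X Y} Γ → T (ht X Y (⋀ Γ)) ⇔ All (T ∘ ht X Y) Γ
  ht-⋀ []      = mk⇔ (λ _ → []) (λ _ → tt)
  ht-⋀ {X} {Y} (R ∷ Γ) = mk⇔
    (λ h → let r , γ = to (T-∧ {ht X Y R}) h in r ∷ to (ht-⋀ Γ) γ)
    (λ { (r ∷ γ) → from T-∧ (r , from (ht-⋀ Γ) γ) })

-- Repetition-free lists with the same members.

module _ {c ℓ} (S : Setoid c ℓ) where

  open Setoid S using (_≈_) renaming (refl to ≈-refl; sym to ≈-sym; trans to ≈-trans)
  open Membership S using () renaming (_∈_ to _∈ˢ_)
  open Permutation S using (_↭_; ↭-refl; ↭-prep; ↭-sym; ↭-trans)

  -- The head of `xs` is located in `ys`, shifted to the front and removed from both lists;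
  -- uniqueness keeps the remaining members the same. This makes sums over the soft stable models
  -- independent of the enumeration.
  unique-same-members⇒↭ : ∀ {xs ys} → Unique S xs → Unique S ys →
    (∀ {z} → z ∈ˢ xs → z ∈ˢ ys) → (∀ {z} → z ∈ˢ ys → z ∈ˢ xs) → xs ↭ ys
  unique-same-members⇒↭ {[]} {[]} _ _ _ _ = ↭-refl
  unique-same-members⇒↭ {[]} {_ ∷ _} _ _ _ ys⊆xs with () ← ys⊆xs (here ≈-refl)
  unique-same-members⇒↭ {x ∷ xs} {ys} (x∉xs ∷ xs!) ys! xs⊆ys ys⊆xs
    with vs , ws , w , x≈w , eq ← ∈-∃++ S (xs⊆ys (here ≈-refl))
    = ↭-trans (↭-prep x (unique-same-members⇒↭ xs! (AllPairs.tail x∷us!) xs⊆us us⊆xs)) (↭-sym ys↭)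
    where
    us = vs ++ ws
    ys↭ : ys ↭ x ∷ us
    ys↭ = ↭-trans (Permutation.refl eq) (Permutationₚ.shift S (≈-sym x≈w) vs ws)
    x∷us! : Unique S (x ∷ us)
    x∷us! = Permutationₚ.Unique-resp-↭ S ys↭ ys!
    drop-head : ∀ {z ts rs} → All (λ t → ¬ x ≈ t) ts → z ∈ˢ ts → z ∈ˢ x ∷ rs → z ∈ˢ rs
    drop-head x∉ts z∈ts (there z∈rs) = z∈rs
    drop-head x∉ts z∈ts (here z≈x)   =
      contradiction (Any.map (≈-trans (≈-sym z≈x)) z∈ts) (All.All¬⇒¬Any x∉ts)
    xs⊆us : ∀ {z} → z ∈ˢ xs → z ∈ˢ us
    xs⊆us z∈xs = drop-head x∉xs z∈xs (Permutationₚ.∈-resp-↭ S ys↭ (xs⊆ys (there z∈xs)))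
    us⊆xs : ∀ {z} → z ∈ˢ us → z ∈ˢ xs
    us⊆xs z∈us = drop-head (AllPairs.head x∷us!) z∈us
      (ys⊆xs (Permutationₚ.∈-resp-↭ S (↭-sym ys↭) (there z∈us)))

-- Soft stable models through here-and-there models.

module Programs (ℝ : RealNumbers) {A : Set} where

  open RealNumbers ℝ
  open RealProperties ℝ
  open LPMLN ℝ

  -- The guard `X ⊨ R` replaces the filter in `satisfied`, so that unions of programs can be treated
  -- rule by rule.
  HT-Model : Program A → Interpretation A → Interpretation A → Set
  HT-Model P X Y = All (λ (_ , R) → X ⊨ R → T (ht X Y R)) P

  atomsᴾ : Program A → List A
  atomsᴾ = concatMap (atoms ∘ proj₂)

  HT-Model-resp : ∀ {X X′ Y Y′} P → Agree (atomsᴾ P) X X′ → Agree (atomsᴾ P) Y Y′ →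
                  HT-Model P X Y → HT-Model P X′ Y′
  HT-Model-resp []            eq eq′ []      = []
  HT-Model-resp ((_ , R) ∷ P) eq eq′ (h ∷ hs) =
    (λ x → subst T (ht-cong R (eq ∘ ∈-++⁺ˡ) (eq′ ∘ ∈-++⁺ˡ))
             (h (subst T (sym (eval-cong R (eq ∘ ∈-++⁺ˡ))) x)))
    ∷ HT-Model-resp P (eq ∘ ∈-++⁺ʳ (atoms R)) (eq′ ∘ ∈-++⁺ʳ (atoms R)) hs

  HT-Model? : ∀ P X Y → Dec (HT-Model P X Y)
  HT-Model? P X Y = All.all? (λ (_ , R) → T? (eval X R) →-dec T? (ht X Y R)) P

  HT-Model-diagonal : ∀ P X → HT-Model P X X
  HT-Model-diagonal P X = All.universal (λ (_ , R) → subst T (sym (ht-diagonal X R))) P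

  models-reduct⇔ : ∀ P {X Y} →
    Models Y (map (reduct X) (drop-weights (satisfied P X))) ⇔ HT-Model P X Y
  models-reduct⇔ [] = mk⇔ (λ _ → []) (λ _ → [])
  models-reduct⇔ ((_ , R) ∷ P) {X} {Y} with eval X R in eq
  ... | false = mk⇔ (λ ms → (λ x → contradiction (subst T eq x) id) ∷ to (models-reduct⇔ P) ms)
                    (λ { (_ ∷ hs) → from (models-reduct⇔ P) hs })
  ... | true  = mk⇔ (λ { (m ∷ ms) → (λ _ → subst T (eval-reduct X Y R) m) ∷ to (models-reduct⇔ P) ms })
                    (λ { (h ∷ hs) → subst T (sym (eval-reduct X Y R)) (h (subst T (sym eq) tt))
                                    ∷ from (models-reduct⇔ P) hs })

  -- By `HT-Model-diagonal`, `X` always models its own reduct, so only minimality remains of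
  -- stability.
  stable⇔ : ∀ P {X} → SM P X ⇔ (∀ Y → Y ⊆ X → HT-Model P X Y → X ⊆ Y)
  stable⇔ P {X} = mk⇔
    (λ (_ , minimal) Y Y⊆X h → minimal Y (from (models-reduct⇔ P) h) Y⊆X)
    (λ minimal → from (models-reduct⇔ P) (HT-Model-diagonal P X) ,
                 λ Y m Y⊆X → minimal Y Y⊆X (to (models-reduct⇔ P) m))

  -- Finite enumeration of the soft stable models.

  module Enumeration (_≟_ : DecidableEquality A) where

    open DecMembership _≟_ using (_∈?_)

    Supported : List A → Interpretation A → Set
    Supported V X = ∀ p → T (X p) → p ∈ V

    restrict : List A → Interpretation A → Interpretation A
    restrict V X p = X p ∧ ⌊ p ∈? V ⌋

    restrict-supported : ∀ V X → Supported V (restrict V X)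
    restrict-supported V X p = toWitness {a? = p ∈? V} ∘ proj₂ ∘ to (T-∧ {X p})

    restrict-⊆ : ∀ V X → restrict V X ⊆ X
    restrict-⊆ V X p = proj₁ ∘ to (T-∧ {X p})

    restrict-mono : ∀ V {X Y} → X ⊆ Y → restrict V X ⊆ restrict V Y
    restrict-mono V {X} X⊆Y p x = let x′ , p∈V = to (T-∧ {X p}) x in from T-∧ (X⊆Y p x′ , p∈V)

    restrict-agrees : ∀ V X → Agree V X (restrict V X)
    restrict-agrees V X {p} p∈V =
      T-ext (λ x → from T-∧ (x , fromWitness {a? = p ∈? V} p∈V)) (proj₁ ∘ to (T-∧ {X p}))

    -- Pointwise equality on all of `A` need not be decidable, but agreement on a finite list is;
    -- between supported interpretations the two coincide by `supported⇒≗`.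
    agreement : List A → DecSetoid 0ℓ 0ℓ
    agreement V = record
      { _≈_ = Agree V
      ; isDecEquivalence = record
        { isEquivalence = record
          { refl  = λ _ → refl
          ; sym   = λ eq p∈V → sym (eq p∈V)
          ; trans = λ eq eq′ p∈V → trans (eq p∈V) (eq′ p∈V)
          }
        ; _≟_ = λ X Y → map′ (λ eqs → All.lookup eqs) (λ eq → All.tabulate eq)
                          (All.all? (λ p → X p ≟ᵇ Y p) V)
        }
      }

    supported⇒≗ : ∀ {V X Y} → Supported V X → Supported V Y → Agree V X Y → X ≗ Y
    supported⇒≗ sX sY eq p = T-ext (λ x → subst T (eq (sX p x)) x) (λ y → subst T (sym (eq (sY p y))) y)

    _[_]≔_ : Interpretation A → A → Bool → Interpretation A
    (X [ v ]≔ b) p = if does (p ≟ v) then b else X p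

    subsets : List A → List (Interpretation A)
    subsets []      = (λ _ → false) ∷ []
    subsets (v ∷ V) = map (_[ v ]≔ true) (subsets V) ++ map (_[ v ]≔ false) (subsets V)

    update-supported : ∀ {v V b X} → Supported V X → Supported (v ∷ V) (X [ v ]≔ b)
    update-supported {v} sX p x with p ≟ v
    ... | yes p≡v = here p≡v
    ... | no  _   = there (sX p x)

    update-agrees : ∀ {v V X Y} → Agree V X Y → Agree (v ∷ V) X (Y [ v ]≔ X v)
    update-agrees {v} eq {p} p∈ with p ≟ v | p∈
    ... | yes refl | _         = refl
    ... | no  p≢v  | here p≡v  = contradiction p≡v p≢v
    ... | no  _    | there p∈V = eq p∈V

    subsets-supported : ∀ V → All (Supported V) (subsets V)
    subsets-supported []      = (λ _ ()) ∷ []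
    subsets-supported (v ∷ V) = All.++⁺
      (All.map⁺ (All.map update-supported (subsets-supported V)))
      (All.map⁺ (All.map update-supported (subsets-supported V)))

    subsets-complete : ∀ V X → Any (Agree V X) (subsets V)
    subsets-complete []      X = here λ ()
    subsets-complete (v ∷ V) X with X v in eq
    ... | true  = Any.++⁺ˡ (Any.map⁺ (Any.map extend (subsets-complete V X)))
      where
      extend : ∀ {Y} → Agree V X Y → Agree (v ∷ V) X (Y [ v ]≔ true)
      extend {Y} ag = subst (λ b → Agree (v ∷ V) X (Y [ v ]≔ b)) eq (update-agrees ag)
    ... | false = Any.++⁺ʳ _ (Any.map⁺ (Any.map extend (subsets-complete V X)))
      where
      extend : ∀ {Y} → Agree V X Y → Agree (v ∷ V) X (Y [ v ]≔ false)
      extend {Y} ag = subst (λ b → Agree (v ∷ V) X (Y [ v ]≔ b)) eq (update-agrees ag)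

    module _ (P : Program A) where

      private
        V : List A
        V = atomsᴾ P

      -- The program sees only the atoms in `V`, so `restrict V X` models the reduct as well as `X`
      -- does, and minimality puts `X` inside it.
      stable⇒supported : ∀ {X} → SM P X → Supported V X
      stable⇒supported {X} s p x = restrict-supported V X p
        (to (stable⇔ P) s (restrict V X) (restrict-⊆ V X)
          (HT-Model-resp P (λ _ → refl) (restrict-agrees V X) (HT-Model-diagonal P X)) p x)

      _⊆ⱽ_ : Interpretation A → Interpretation A → Set
      X ⊆ⱽ Y = All (λ p → T (X p) → T (Y p)) V

      _⊆ⱽ?_ : ∀ X Y → Dec (X ⊆ⱽ Y)
      X ⊆ⱽ? Y = All.all? (λ p → T? (X p) →-dec T? (Y p)) V

      ⊆ⱽ-resp : ∀ {X X′ Y Y′} → Agree V X X′ → Agree V Y Y′ → X ⊆ⱽ Y → X′ ⊆ⱽ Y′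
      ⊆ⱽ-resp eq eq′ X⊆Y = All.tabulate λ p∈V →
        subst T (eq′ p∈V) ∘ All.lookup X⊆Y p∈V ∘ subst T (sym (eq p∈V))

      -- Stability with the competitors of X limited to a finite list, which
      -- makes it decidable.
      Stableⱽ : Interpretation A → Set
      Stableⱽ X = All (λ Y → Y ⊆ⱽ X → HT-Model P X Y → X ⊆ⱽ Y) (subsets V)

      Stableⱽ? : Decidable Stableⱽ
      Stableⱽ? X = All.all? (λ Y → (Y ⊆ⱽ? X) →-dec (HT-Model? P X Y →-dec (X ⊆ⱽ? Y))) (subsets V)

      Stableⱽ-resp : ∀ {X X′} → Agree V X X′ → Stableⱽ X → Stableⱽ X′
      Stableⱽ-resp eq = All.map λ minimal Y⊆X′ h →
        ⊆ⱽ-resp eq (λ _ → refl) (minimal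
          (⊆ⱽ-resp (λ _ → refl) (λ p∈V → sym (eq p∈V)) Y⊆X′)
          (HT-Model-resp P (λ p∈V → sym (eq p∈V)) (λ _ → refl) h))

      stable⇒Stableⱽ : ∀ {X} → SM P X → Stableⱽ X
      stable⇒Stableⱽ s = All.map
        (λ sY Y⊆X h → All.universal (to (stable⇔ P) s _ (λ p y → All.lookup Y⊆X (sY p y) y) h) V)
        (subsets-supported V)

      -- An arbitrary competitor `Y` is exchanged for the listed `Z` that agrees with it on `V`.
      -- Since `X` is supported, the conclusion `X ⊆ Y` is also decided on `V`.
      Stableⱽ⇒stable : ∀ {X} → Supported V X → Stableⱽ X → SM P X
      Stableⱽ⇒stable {X} sX st = from (stable⇔ P) minimal
        where
        minimal : ∀ Y → Y ⊆ X → HT-Model P X Y → X ⊆ Y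
        minimal Y Y⊆X h p x = subst T (sym (Y≡Z p∈V)) (All.lookup
          (minimalⱽ (All.tabulate λ {q} q∈V z → Y⊆X q (subst T (sym (Y≡Z q∈V)) z))
                    (HT-Model-resp P (λ _ → refl) Y≡Z h))
          p∈V x)
          where
          Y∈subsets = subsets-complete V Y
          minimalⱽ = proj₁ (All.lookupAny st Y∈subsets)
          Y≡Z : Agree V Y (Any.lookup Y∈subsets)
          Y≡Z = proj₂ (All.lookupAny st Y∈subsets)
          p∈V = sX p x

      -- A proof of `Probability` contains an enumeration, so one must be constructed before strong
      -- equivalence can be applied to a chosen `H`.
      enumerateSM : ∃ (EnumeratesSM P)
      enumerateSM = L , unique , λ Y → mk⇔ sound complete
        where
        D = agreement V
        open DecSetoid D using () renaming (setoid to S; _≟_ to _≟ⱽ_)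
        -- Atoms repeated in `V` make `subsets` list the same set several times.
        candidates = deduplicate _≟ⱽ_ (subsets V)
        L = filter Stableⱽ? candidates
        unique : Unique (A →-setoid Bool) L
        unique = AllPairs.map (λ X≉Y X≗Y → X≉Y λ {p} _ → X≗Y p)
          (filter⁺ S Stableⱽ? (deduplicate-! D (subsets V)))
        L-supported : All (Supported V) L
        L-supported = All.filter⁺ Stableⱽ? (All.deduplicate⁺ _≟ⱽ_ (subsets-supported V))
        sound : ∀ {Y} → Any (Y ≗_) L → SM P Y
        sound Y∈L = let Z , Z∈L , Y≗Z = find Y∈L in Stableⱽ⇒stable
          (λ p y → All.lookup L-supported Z∈L p (subst T (Y≗Z p) y))
          (proj₂ (∈-filter⁻ S Stableⱽ? Stableⱽ-resp {xs = candidates}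
            (Any.map (λ Y≗Z {p} _ → Y≗Z p) Y∈L)))
        complete : ∀ {Y} → SM P Y → Any (Y ≗_) L
        complete {Y} s =
          let Z , Z∈L , Y≡Z = find (∈-filter⁺ S Stableⱽ? Stableⱽ-resp
                (∈-deduplicate⁺ S _≟ⱽ_ (λ eq eq′ p∈V → trans (eq′ p∈V) (sym (eq p∈V))) (subsets-complete V Y))
                (stable⇒Stableⱽ s))
          in lose Z∈L (supported⇒≗ (stable⇒supported s) (All.lookup L-supported Z∈L) Y≡Z)

-- Weights, counterweights, partition functions and probabilities.

module Weights (ℝ : RealNumbers) {A : Set} where

  open RealNumbers ℝ
  open RealProperties ℝ
  open LPMLN ℝ
  open Programs ℝ {A}

  weight : Program A → Carrier → Carrier
  weight P a = ∑ (map (λ (w , _) → weight-at {A} a w) P)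

  weight-++ : ∀ P Q a → weight (P ∪ Q) a ≡ weight P a + weight Q a
  weight-++ []            Q a = sym (+-identityˡ _)
  weight-++ ((w , _) ∷ P) Q a =
    trans (+-congˡ {weight-at {A} a w} (weight-++ P Q a)) (sym (+-assoc (weight-at {A} a w) _ _))

  weight-affine : ∀ P a → weight P a ≡ ∑ (soft-weights P) + hard-count P · a
  weight-affine []                 a = sym (+-identityˡ 0#)
  weight-affine ((soft w , _) ∷ P) a =
    trans (+-congˡ {w} (weight-affine P a)) (sym (+-assoc w _ _))
  weight-affine ((hard   , _) ∷ P) a = trans (+-congˡ {a} (weight-affine P a))
    (solve 3 (λ a s h → a :+ (s :+ h) := s :+ (a :+ h)) refl a _ _)

  weight-satisfied-++ : ∀ P Q X a →
    weight (satisfied (P ∪ Q) X) a ≡ weight (satisfied P X) a + weight (satisfied Q X) a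
  weight-satisfied-++ P Q X a = trans
    (cong (λ R → weight R a) (filter-++ (λ (_ , R) → T? (eval X R)) P Q))
    (weight-++ (satisfied P X) (satisfied Q X) a)

  weight-split : ∀ P X a →
    weight (satisfied P X) a + weight (unsatisfied P X) a ≡ weight P a
  weight-split []            X a = +-identityˡ 0#
  weight-split ((w , R) ∷ P) X a with eval X R
  ... | true  = trans (+-assoc (weight-at {A} a w) _ _) (+-congˡ {weight-at {A} a w} (weight-split P X a))
  ... | false = trans (solve 3 (λ s w u → s :+ (w :+ u) := w :+ (s :+ u)) refl _ (weight-at {A} a w) _)
                      (+-congˡ {weight-at {A} a w} (weight-split P X a))

  filterᵇ-cong : ∀ {B : Set} {f g : B → Bool} {xs} →
                 All (λ x → f x ≡ g x) xs → filterᵇ f xs ≡ filterᵇ g xs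
  filterᵇ-cong [] = refl
  filterᵇ-cong {f = f} {g} {x ∷ _} (eq ∷ eqs) with f x | g x | eq
  ... | true  | true  | refl = cong (x ∷_) (filterᵇ-cong eqs)
  ... | false | false | refl = filterᵇ-cong eqs

  eval-agrees : ∀ P {X Y} → Agree (atomsᴾ P) X Y → All (λ (_ , R) → eval X R ≡ eval Y R) P
  eval-agrees []            eq = []
  eval-agrees ((_ , R) ∷ P) eq = eval-cong R (eq ∘ ∈-++⁺ˡ) ∷ eval-agrees P (eq ∘ ∈-++⁺ʳ (atoms R))

  satisfied-cong : ∀ P {X Y} → Agree (atomsᴾ P) X Y → satisfied P X ≡ satisfied P Y
  satisfied-cong P eq = filterᵇ-cong (eval-agrees P eq)

  unsatisfied-cong : ∀ P {X Y} → Agree (atomsᴾ P) X Y → unsatisfied P X ≡ unsatisfied P Y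
  unsatisfied-cong P eq = filterᵇ-cong (All.map (cong not) (eval-agrees P eq))

  neutral : List (Formula A) → Program A
  neutral = map (soft 0# ,_)

  negations : Program A → Program A
  negations = map λ (w , R) → w , ¬ᶠ R

  weight-neutral : ∀ Γ X a → weight (satisfied (neutral Γ) X) a ≡ 0#
  weight-neutral []      X a = refl
  weight-neutral (R ∷ Γ) X a with eval X R
  ... | true  = trans (+-identityˡ _) (weight-neutral Γ X a)
  ... | false = weight-neutral Γ X a

  weight-negations : ∀ P X a → weight (satisfied (negations P) X) a ≡ weight (unsatisfied P X) a
  weight-negations []            X a = refl
  weight-negations ((w , R) ∷ P) X a with eval X R
  ... | true  = weight-negations P X a
  ... | false = +-congˡ (weight-negations P X a)

  -- Exactly one of R and ¬ R is satisfied, so P ∪ counterweight P Γ gives all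
  -- interpretations the same weight.
  counterweight : Program A → List (Formula A) → Program A
  counterweight P Γ = neutral Γ ∪ negations P

  weight-counterweight : ∀ P Γ X a →
    weight (satisfied (counterweight P Γ) X) a ≡ weight (unsatisfied P X) a
  weight-counterweight P Γ X a = trans (weight-satisfied-++ (neutral Γ) (negations P) X a)
    (trans (cong₂ _+_ (weight-neutral Γ X a) (weight-negations P X a)) (+-identityˡ _))

  weight-balanced : ∀ P Γ X a → weight (satisfied (P ∪ counterweight P Γ) X) a ≡ weight P a
  weight-balanced P Γ X a = trans (weight-satisfied-++ P (counterweight P Γ) X a)
    (trans (+-congˡ {weight (satisfied P X) a} (weight-counterweight P Γ X a)) (weight-split P X a))

  -- By `ht-¬` a negated rule true in `X` holds at every `(X , Y)`. The negations therefore shift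
  -- weights only, and stability is controlled by `Γ`.
  HT-Model-counterweight : ∀ P Γ {X Y} →
    HT-Model (counterweight P Γ) X Y ⇔ All (λ R → X ⊨ R → T (ht X Y R)) Γ
  HT-Model-counterweight P Γ {X} {Y} = mk⇔
    (λ h → All.map⁻ (All.++⁻ˡ (neutral Γ) h))
    (λ h → All.++⁺ (All.map⁺ h)
      (All.map⁺ (All.universal (λ (_ , R) → subst T (sym (ht-¬ X Y R))) P)))

  -- The `Any` argument stands for nonemptiness of `L`, in the form in which membership of a stable
  -- model in an enumeration provides it.
  ∑-pos : ∀ {B : Set} {f : B → Carrier} {Q : B → Set} {L} →
          (∀ y → 0# < f y) → Any Q L → 0# < ∑ (map f L)
  ∑-nonneg : ∀ {B : Set} {f : B → Carrier} L → (∀ y → 0# < f y) → 0# ≤ ∑ (map f L)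
  ∑-nonneg []      f-pos = ≤-refl
  ∑-nonneg (y ∷ L) f-pos = <⇒≤ (∑-pos {Q = λ _ → ⊤} f-pos (here {xs = L} tt))
  ∑-pos {L = y ∷ L} f-pos _ = +-pos-nonneg (f-pos y) (∑-nonneg L f-pos)

  ∑-scale : ∀ {B : Set} {f g : B → Carrier} {c d} L →
            (∀ y → f y * c ≡ g y * d) → ∑ (map f L) * c ≡ ∑ (map g L) * d
  ∑-scale {c = c} {d} []      eq = trans (zeroˡ c) (sym (zeroˡ d))
  ∑-scale {c = c} {d} (y ∷ L) eq = trans (distribʳ c _ _)
    (trans (cong₂ _+_ (eq y) (∑-scale L eq)) (sym (distribʳ d _ _)))

  partition-function : Program A → List (Interpretation A) → Carrier → Carrier
  partition-function P L a = ∑ (map (λ Y → TW (satisfied P Y) a) L)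

  partition-function-pos : ∀ P {Q : Interpretation A → Set} {L} a → Any Q L → 0# < partition-function P L a
  partition-function-pos P a = ∑-pos λ Y → exp-pos (weight (satisfied P Y) a)

  -- Two probabilities may come with different enumerations; this gives them a common denominator.
  partition-function-unique : ∀ P {L L′} → EnumeratesSM P L → EnumeratesSM P L′ →
    ∀ a → partition-function P L a ≡ partition-function P L′ a
  partition-function-unique P (L! , L⇔) (L′! , L′⇔) a =
    Permutationₚ.foldr-commMonoid (setoid Carrier) +-isCommutativeMonoid
      (Permutationₚ.map⁺ (A →-setoid Bool) (setoid Carrier)
        (λ X≗Y → cong (λ Q → TW Q a) (satisfied-cong P (λ {p} _ → X≗Y p)))
        (unique-same-members⇒↭ (A →-setoid Bool) L! L′!
          (λ {Z} → from (L′⇔ Z) ∘ to (L⇔ Z)) (λ {Z} → from (L⇔ Z) ∘ to (L′⇔ Z))))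

  size : List (Interpretation A) → Carrier
  size L = ∑ (map (λ _ → 1#) L)

  size-pos : ∀ {Q : Interpretation A → Set} {L} → Any Q L → 0# < size L
  size-pos = ∑-pos λ _ → 0<1

  Limit∞-cong : ∀ {f g : Carrier → Carrier} {r} → f ≗ g → Limit∞ f r → Limit∞ g r
  Limit∞-cong {r = r} f≗g lim ε 0<ε = let N , near = lim ε 0<ε in
    N , λ a N≤a → subst (λ y → r - ε < y × y < r + ε) (f≗g a) (near a N≤a)

  Limit∞-const : ∀ r → Limit∞ (λ _ → r) r
  Limit∞-const r ε 0<ε = 0# , λ _ _ →
    +-cancelˡ-< ε (subst₂ _<_ (sym (x+y-x ε r)) (+-comm r ε) r<r+ε) , r<r+ε
    where
    r<r+ε : r < r + ε
    r<r+ε = subst (_< r + ε) (+-identityʳ r) (+-monoʳ-< r 0<ε)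

  -- Every summand of the denominator equals the numerator `exp c`, and this common factor cancels.
  uniform-ratio : ∀ P {Q : Interpretation A → Set} {L} {c} X a →
    (∀ Y → weight (satisfied P Y) a ≡ c) → Any Q L →
    TW (satisfied P X) a / partition-function P L a ≡ 1# / size L
  uniform-ratio P {L = L} {c} X a uniform inhabited =
    cross-multiply (partition-function-pos P a inhabited) (size-pos inhabited)
      (trans (cong (_* size L) (cong exp (uniform X)))
      (trans (*-comm _ _)
      (trans (∑-scale L λ Y → trans (*-comm 1# _) (cong (_* 1#) (cong exp (sym (uniform Y)))))
      (*-comm _ 1#))))

  -- The quotient is constant in `a`, so its limit is immediate.
  uniform-probability : ∀ P {L} {c : Carrier → Carrier} {X} → (∀ a Y → weight (satisfied P Y) a ≡ c a) →
    EnumeratesSM P L → SM P X → Probability P X (1# / size L)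
  uniform-probability P {L} {X = X} uniform enum@(_ , L⇔) s = yes s , L , enum ,
    Limit∞-cong (λ a → sym (uniform-ratio P X a (uniform a) (from (L⇔ X) s))) (Limit∞-const _)

  unstable-probability : ∀ P {L X} → EnumeratesSM P L → ¬ SM P X → Probability P X 0#
  unstable-probability P {L} enum ¬s = no ¬s , L , enum ,
    Limit∞-cong (λ a → sym (zeroˡ (partition-function P L a ⁻¹))) (Limit∞-const 0#)

  uniform-probability-≢0 : ∀ P {c : Carrier → Carrier} {X} → (∀ a Y → weight (satisfied P Y) a ≡ c a) →
    SM P X → ¬ Probability P X 0#
  uniform-probability-≢0 P uniform s (no ¬s , _) = ¬s s
  uniform-probability-≢0 P {X = X} uniform s (yes _ , L , (_ , L⇔) , lim) =
    let X∈L = from (L⇔ X) s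
        -- The quotient is constantly `1# / size L`, so it is not strictly within that same distance
        -- of 0.
        N , near = lim (1# / size L) (*-pos 0<1 (⁻¹-pos (size-pos X∈L)))
    in proj₂ (proj₂ (near N ≤-refl))
         (trans (uniform-ratio P X N (uniform N) X∈L) (sym (+-identityˡ _)))

  equal-probabilities⇒≲ : ∀ P {X Y r} → 0# < r → SM P X → SM P Y →
    Probability P X r → Probability P Y r → weight (satisfied P X) ≲ weight (satisfied P Y)
  equal-probabilities⇒≲ P 0<r sX sY (no ¬s , _) _ = contradiction sX ¬s
  equal-probabilities⇒≲ P 0<r sX sY _ (no ¬s , _) = contradiction sY ¬s
  equal-probabilities⇒≲ P {X} {Y} 0<r sX sY (yes _ , L , enum , lim) (yes _ , L′ , enum′ , lim′) =
    equal-limits⇒≲ 0<r (λ a → partition-function-pos P a (from (proj₂ enum X) sX)) lim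
      (Limit∞-cong (λ a → cong (TW (satisfied P Y) a /_) (partition-function-unique P enum′ enum a)) lim′)

  ≲-cong : ∀ {p p′ q q′ : Carrier → Carrier} → p ≗ p′ → q ≗ q′ → p ≲ q → p′ ≲ q′
  ≲-cong p≗p′ q≗q′ le ε 0<ε = let N , below = le ε 0<ε in
    N , λ a N≤a → subst₂ (λ x y → x < y + ε) (p≗p′ a) (q≗q′ a) (below a N≤a)

  ≲-cancel : ∀ {p q : Carrier → Carrier} (t : Carrier → Carrier) → (λ a → t a + p a) ≲ (λ a → t a + q a) → p ≲ q
  ≲-cancel {p} {q} t le ε 0<ε = let N , below = le ε 0<ε in
    N , λ a N≤a → +-cancelˡ-< (t a) (subst (t a + p a <_) (+-assoc (t a) (q a) ε) (below a N≤a))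

  module _ (F G : Program A) where

    -- The weight of `G ∪ counterweight F Γ` at `Z` is the total weight of `G`, minus what `Z`
    -- violates in `G`, plus what it violates in `F`. Adding the violated weights of `G` at both `X`
    -- and `Y` removes the subtractions, and the total cancels.
    unsatisfied-≲ : ∀ Γ {X Y} →
      weight (satisfied (G ∪ counterweight F Γ) X) ≲ weight (satisfied (G ∪ counterweight F Γ) Y) →
      (λ a → weight (unsatisfied F X) a + weight (unsatisfied G Y) a) ≲
      (λ a → weight (unsatisfied F Y) a + weight (unsatisfied G X) a)
    unsatisfied-≲ Γ {X} {Y} le = ≲-cancel (weight G) λ ε 0<ε → let N , below = le ε 0<ε in
      N , λ a N≤a → subst₂ _<_ (eq₁ a) (eq₂ a ε) (+-monoˡ-< (u G X a + u G Y a) (below a N≤a))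
      where
      u : Program A → Interpretation A → Carrier → Carrier
      u P Z = weight (unsatisfied P Z)
      E : Interpretation A → Carrier → Carrier
      E Z = weight (satisfied (G ∪ counterweight F Γ) Z)
      E+u : ∀ Z a → E Z a + u G Z a ≡ weight G a + u F Z a
      E+u Z a = trans (cong (_+ u G Z a) (trans (weight-satisfied-++ G (counterweight F Γ) Z a)
          (+-congˡ (weight-counterweight F Γ Z a))))
        (trans (solve 3 (λ s u v → s :+ u :+ v := s :+ v :+ u) refl (weight (satisfied G Z) a) (u F Z a) (u G Z a))
          (cong (_+ u F Z a) (weight-split G Z a)))
      eq₁ : ∀ a → E X a + (u G X a + u G Y a) ≡ weight G a + (u F X a + u G Y a)
      eq₁ a = trans (sym (+-assoc _ _ _)) (trans (cong (_+ u G Y a) (E+u X a)) (+-assoc _ _ _))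
      eq₂ : ∀ a ε → E Y a + ε + (u G X a + u G Y a) ≡ weight G a + (u F Y a + u G X a) + ε
      eq₂ a ε = trans
        (solve 4 (λ e ε x y → e :+ ε :+ (x :+ y) := e :+ y :+ (x :+ ε)) refl (E Y a) ε (u G X a) (u G Y a))
        (trans (cong (_+ (u G X a + ε)) (E+u Y a))
          (solve 4 (λ t u x ε → t :+ u :+ (x :+ ε) := t :+ (u :+ x) :+ ε) refl (weight G a) (u F Y a) (u G X a) ε))

-- Constant differences in an abelian group.

module ExchangeLaws {c ℓ} (M : AbelianGroup c ℓ) where

  open AbelianGroup M
  open CommutativeSemigroupProperties commutativeSemigroup using (xy∙z≈xz∙y)
  open GroupProperties group using (//-rightDividesʳ)
  open ≈-Reasoning (AbelianGroup.setoid M)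

  -- The same rearrangement serves the reals for (1a) and the integers for (1b), hence the general
  -- group.
  exchange⇒difference : ∀ {w x y z} → x ∙ w ≈ y ∙ z → x ≈ y ∙ w ⁻¹ ∙ z
  exchange⇒difference {w} {x} {y} {z} xw≈yz = begin
    x               ≈⟨ //-rightDividesʳ w x ⟨
    x ∙ w ∙ w ⁻¹    ≈⟨ ∙-congʳ xw≈yz ⟩
    y ∙ z ∙ w ⁻¹    ≈⟨ xy∙z≈xz∙y y z (w ⁻¹) ⟩
    y ∙ w ⁻¹ ∙ z    ∎

  difference⇒exchange : ∀ d {w x y z} → x ≈ d ∙ z → y ≈ d ∙ w → x ∙ w ≈ y ∙ z
  difference⇒exchange d {w} {x} {y} {z} x≈dz y≈dw = begin
    x ∙ w      ≈⟨ ∙-congʳ x≈dz ⟩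
    d ∙ z ∙ w  ≈⟨ xy∙z≈xz∙y d z w ⟩
    d ∙ w ∙ z  ≈⟨ ∙-congʳ y≈dw ⟨
    y ∙ z      ∎

-- Conditions (1) and (2) as relations between programs.

module Characterisation (ℝ : RealNumbers) {A : Set} (_≟_ : DecidableEquality A) where

  open RealNumbers ℝ
  open RealProperties ℝ
  open LPMLN ℝ
  open Programs ℝ {A}
  open Enumeration _≟_
  open Weights ℝ {A}
  module ℝ-Exchange = ExchangeLaws +-abelianGroup
  module ℤ-Exchange = ExchangeLaws ℤ.+-0-abelianGroup

  soft-unsat : Program A → Interpretation A → Carrier
  soft-unsat P X = ∑ (soft-weights (unsatisfied P X))

  hard-unsat : Program A → Interpretation A → ℕ
  hard-unsat P X = hard-count (unsatisfied P X)

  -- Constancy of the differences in X, with the terms moved so that no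
  -- subtraction occurs.
  SameDifferences : Program A → Program A → Set
  SameDifferences F G = ∀ X Y →
    soft-unsat F X + soft-unsat G Y ≡ soft-unsat F Y + soft-unsat G X ×
    hard-unsat F X ℕ.+ hard-unsat G Y ≡ hard-unsat F Y ℕ.+ hard-unsat G X

  _HT-entails_ : Program A → Program A → Set
  F HT-entails G = ∀ X Y → Y ⊆ X → HT-Model F X Y → HT-Model G X Y

  weight-unsatisfied-+ : ∀ F G X Y a →
    weight (unsatisfied F X) a + weight (unsatisfied G Y) a ≡
    soft-unsat F X + soft-unsat G Y + (hard-unsat F X ℕ.+ hard-unsat G Y) · a
  weight-unsatisfied-+ F G X Y a = begin-equality
    weight (unsatisfied F X) a + weight (unsatisfied G Y) a
      ≡⟨ cong₂ _+_ (weight-affine (unsatisfied F X) a) (weight-affine (unsatisfied G Y) a) ⟩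
    (s + m · a) + (t + n · a)
      ≡⟨ solve 4 (λ s ma t na → (s :+ ma) :+ (t :+ na) := s :+ t :+ (ma :+ na)) refl s (m · a) t (n · a) ⟩
    s + t + (m · a + n · a)
      ≡⟨ +-congˡ {s + t} (×-homo-+ a m n) ⟨
    s + t + (m ℕ.+ n) · a ∎
    where
    s = soft-unsat F X
    t = soft-unsat G Y
    m = hard-unsat F X
    n = hard-unsat G Y

  -- Sufficiency of the conditions.

  module _ (F G : Program A) (same : SameDifferences F G) where

    unsatisfied-exchange : ∀ X Y a →
      weight (unsatisfied F X) a + weight (unsatisfied G Y) a ≡
      weight (unsatisfied F Y) a + weight (unsatisfied G X) a
    unsatisfied-exchange X Y a = trans (weight-unsatisfied-+ F G X Y a)
      (trans (cong₂ (λ s n → s + n · a) (proj₁ (same X Y)) (proj₂ (same X Y)))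
        (sym (weight-unsatisfied-+ F G Y X a)))

    -- Adding the corresponding unsatisfied weights turns either side into the total weight of `F`
    -- and `G`, and the added amounts agree by `unsatisfied-exchange`.
    satisfied-exchange : ∀ X Y a →
      weight (satisfied F X) a + weight (satisfied G Y) a ≡
      weight (satisfied F Y) a + weight (satisfied G X) a
    satisfied-exchange X Y a = +-cancelʳ (u F X + u G Y) _ _ (begin-equality
      s F X + s G Y + (u F X + u G Y)    ≡⟨ totals X Y ⟩
      weight F a + weight G a            ≡⟨ totals Y X ⟨
      s F Y + s G X + (u F Y + u G X)    ≡⟨ +-congˡ {s F Y + s G X} (unsatisfied-exchange X Y a) ⟨
      s F Y + s G X + (u F X + u G Y)    ∎)
      where
      s u : Program A → Interpretation A → Carrier
      s P Z = weight (satisfied P Z) a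
      u P Z = weight (unsatisfied P Z) a
      totals : ∀ X Y → s F X + s G Y + (u F X + u G Y) ≡ weight F a + weight G a
      totals X Y = trans
        (solve 4 (λ s t u v → s :+ t :+ (u :+ v) := (s :+ u) :+ (t :+ v)) refl (s F X) (s G Y) (u F X) (u G Y))
        (cong₂ _+_ (weight-split F X a) (weight-split G Y a))

    -- This is proportionality of the weights in cross-multiplied form: the quotient of the two
    -- weights is the same at `X` and at `Y`. On either side `H` contributes once at `X` and once at
    -- `Y`.
    TW-exchange : ∀ H X Y a →
      TW (satisfied (G ∪ H) Y) a * TW (satisfied (F ∪ H) X) a ≡
      TW (satisfied (F ∪ H) Y) a * TW (satisfied (G ∪ H) X) a
    TW-exchange H X Y a = begin-equality
      exp (w G Y) * exp (w F X)                    ≡⟨ exp-+ (w G Y) (w F X) ⟨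
      exp (w G Y + w F X)                          ≡⟨ cong exp (cong₂ _+_ (w-++ G Y) (w-++ F X)) ⟩
      exp ((s G Y + s H Y) + (s F X + s H X))      ≡⟨ cong exp (regroup (s G Y) (s H Y) (s F X) (s H X)) ⟩
      exp ((s F X + s G Y) + (s H X + s H Y))      ≡⟨ cong (λ z → exp (z + (s H X + s H Y))) (satisfied-exchange X Y a) ⟩
      exp ((s F Y + s G X) + (s H X + s H Y))      ≡⟨ cong exp (regroup′ (s F Y) (s H Y) (s G X) (s H X)) ⟨
      exp ((s F Y + s H Y) + (s G X + s H X))      ≡⟨ cong exp (cong₂ _+_ (w-++ F Y) (w-++ G X)) ⟨
      exp (w F Y + w G X)                          ≡⟨ exp-+ (w F Y) (w G X) ⟩
      exp (w F Y) * exp (w G X)                    ∎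
      where
      s w : Program A → Interpretation A → Carrier
      s P Z = weight (satisfied P Z) a
      w P Z = weight (satisfied (P ∪ H) Z) a
      w-++ : ∀ P Z → w P Z ≡ s P Z + s H Z
      w-++ P Z = weight-satisfied-++ P H Z a
      regroup : ∀ b c d e → (b + c) + (d + e) ≡ (d + b) + (e + c)
      regroup = solve 4 (λ b c d e → (b :+ c) :+ (d :+ e) := (d :+ b) :+ (e :+ c)) refl
      regroup′ : ∀ b c d e → (b + c) + (d + e) ≡ (b + d) + (e + c)
      regroup′ = solve 4 (λ b c d e → (b :+ c) :+ (d :+ e) := (b :+ d) :+ (e :+ c)) refl

    -- Summing `TW-exchange` over the `Y` in `L` relates the two denominators by the same
    -- cross-multiplied proportion.
    ratio-exchange : ∀ H {Q : Interpretation A → Set} {L} X a → Any Q L →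
      TW (satisfied (F ∪ H) X) a / partition-function (F ∪ H) L a ≡
      TW (satisfied (G ∪ H) X) a / partition-function (G ∪ H) L a
    ratio-exchange H {L = L} X a inhabited = cross-multiply
      (partition-function-pos (F ∪ H) a inhabited) (partition-function-pos (G ∪ H) a inhabited)
      (trans (*-comm _ _) (trans (∑-scale L (λ Y → TW-exchange H X Y a)) (*-comm _ _)))

    transfer-probability : F HT-entails G → G HT-entails F → ∀ H {X r} →
      Probability (F ∪ H) X r → Probability (G ∪ H) X r
    transfer-probability F⊑G G⊑F H {X} {r} (d , L , (L! , L⇔) , lim) = helper d lim
      where
      -- The entailment runs against the transfer: a competitor of `Y` for `Q ∪ H` has to become one
      -- for `P ∪ H`.
      transfer-stable : ∀ {P Q} → Q HT-entails P → ∀ {Y} → SM (P ∪ H) Y → SM (Q ∪ H) Y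
      transfer-stable {P} {Q} Q⊑P {Y} s = from (stable⇔ (Q ∪ H)) λ Z Z⊆Y h →
        to (stable⇔ (P ∪ H)) s Z Z⊆Y (All.++⁺ (Q⊑P Y Z Z⊆Y (All.++⁻ˡ Q h)) (All.++⁻ʳ Q h))
      enum : EnumeratesSM (G ∪ H) L
      enum = L! , λ Y → mk⇔ (transfer-stable G⊑F ∘ to (L⇔ Y)) (from (L⇔ Y) ∘ transfer-stable F⊑G)
      helper : (d : Dec (SM (F ∪ H) X)) →
        Limit∞ (λ a → W (F ∪ H) X d a / partition-function (F ∪ H) L a) r → Probability (G ∪ H) X r
      helper (yes s) lim = yes (transfer-stable G⊑F s) , L , enum ,
        Limit∞-cong (λ a → ratio-exchange H X a (from (L⇔ X) s)) lim
      helper (no ¬s) lim = no (¬s ∘ transfer-stable F⊑G) , L , enum ,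
        Limit∞-cong (λ a → trans (zeroˡ _) (sym (zeroˡ (partition-function (G ∪ H) L a ⁻¹)))) lim

  -- Necessity of the conditions.

  choices : List A → List (Formula A)
  choices = map (choice ∘ atom)

  -- For each `p` in `X`, the rule `choice (atom p)` is true in `X` and forces `p` into every
  -- competitor; `V` covers all of `X`.
  choices⇒stable : ∀ P Q {V X} → Supported V X → SM (P ∪ counterweight Q (choices V)) X
  choices⇒stable P Q {V} {X} sX = from (stable⇔ (P ∪ counterweight Q (choices V))) λ Y _ h p x →
    let hs = All.map⁻ (to (HT-Model-counterweight Q (choices V)) (All.++⁻ʳ P h))
        y = to (ht-choice {A} {X} {Y} (atom p)) (All.lookup hs (sX p x) (from (T-∨ {X p}) (inj₁ x))) x
    in proj₂ (to (T-∧ {X p}) y)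

  module _ {F G : Program A} (F≡G : StronglyEquivalent F G) where

    private
      V : List A
      V = atomsᴾ F ++ atomsᴾ G

    -- For `F ∪ H` all supported interpretations are stable with the same probability `r`. Strong
    -- equivalence carries `r` over to `G ∪ H`, whose weights expose the difference between `F` and
    -- `G`.
    supported⇒≲ : ∀ {X Y} → Supported V X → Supported V Y →
      (λ a → soft-unsat F X + soft-unsat G Y + (hard-unsat F X ℕ.+ hard-unsat G Y) · a) ≲
      (λ a → soft-unsat F Y + soft-unsat G X + (hard-unsat F Y ℕ.+ hard-unsat G X) · a)
    supported⇒≲ {X} {Y} sX sY =
      ≲-cong (weight-unsatisfied-+ F G X Y) (weight-unsatisfied-+ F G Y X)
        (unsatisfied-≲ F G (choices V) (equal-probabilities⇒≲ (G ∪ H) 0<r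
          (choices⇒stable G F sX) (choices⇒stable G F sY) (probability sX) (probability sY)))
      where
      H = counterweight F (choices V)
      L = proj₁ (enumerateSM (F ∪ H))
      enum = proj₂ (enumerateSM (F ∪ H))
      r = 1# / size L
      0<r : 0# < r
      0<r = *-pos 0<1 (⁻¹-pos (size-pos (from (proj₂ enum X) (choices⇒stable F F sX))))
      probability : ∀ {Z} → Supported V Z → Probability (G ∪ H) Z r
      probability {Z} sZ = to (F≡G H Z r) (uniform-probability (F ∪ H)
        (λ a Y → weight-balanced F (choices V) Y a) enum (choices⇒stable F F sZ))

    -- Which rules are violated depends only on atoms in `V`, so `X` and `Y` may be cut down to
    -- supported interpretations. Comparison in both directions then identifies constants and
    -- slopes.
    same-differences : SameDifferences F G
    same-differences X Y
      rewrite unsatisfied-cong F {X} {restrict V X} (restrict-agrees V X ∘ ∈-++⁺ˡ)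
            | unsatisfied-cong F {Y} {restrict V Y} (restrict-agrees V Y ∘ ∈-++⁺ˡ)
            | unsatisfied-cong G {X} {restrict V X} (restrict-agrees V X ∘ ∈-++⁺ʳ (atomsᴾ F))
            | unsatisfied-cong G {Y} {restrict V Y} (restrict-agrees V Y ∘ ∈-++⁺ʳ (atomsᴾ F))
      = affine-≲-antisym _ _ (supported⇒≲ sX sY) (supported⇒≲ sY sX)
      where
      sX = restrict-supported V X
      sY = restrict-supported V Y

  -- For Y ⊆ X, the only Z with Y ⊆ Z ⊆ X such that (X , Z) satisfies all
  -- separators are, on V, Y and X themselves.
  separators : List A → Interpretation A → List (Formula A)
  separators V Y = cartesianProductWith (λ p q → if Y p then atom p else (atom p ⇒ᶠ atom q)) V V

  -- The atoms among the separators lie in `Y`, and the implications have antecedents outside `Y`.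
  separators-hold : ∀ V {X Y} → All (λ R → X ⊨ R → T (ht X Y R)) (separators V Y)
  separators-hold V {X} {Y} = All.cartesianProductWith⁺ (setoid A) (setoid A) _ V V λ {p} {q} _ _ → holds p q
    where
    holds : ∀ p q (let R = if Y p then atom p else (atom p ⇒ᶠ atom q)) → X ⊨ R → T (ht X Y R)
    holds p q with Y p in eq
    ... | true  = λ x → from T-∧ (x , subst T (sym eq) tt)
    ... | false = λ x → from (T-∧ {not (X p ∧ Y p) ∨ (X q ∧ Y q)})
      ( from (T-⇒ {X p ∧ Y p}) (λ h → contradiction (subst T eq (proj₂ (to (T-∧ {X p}) h))) id) , x)

  module _ {V : List A} {X Y Z : Interpretation A} (Y⊆X : Y ⊆ X)
           (sep : All (λ R → X ⊨ R → T (ht X Z R)) (separators V Y)) where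

    private
      sep-at : ∀ {p q} → p ∈ V → q ∈ V →
        let R = if Y p then atom p else (atom p ⇒ᶠ atom q) in X ⊨ R → T (ht X Z R)
      sep-at p∈V q∈V = All.lookup sep (∈-cartesianProductWith⁺ _ p∈V q∈V)

    separators⇒⊆ : ∀ {p} → p ∈ V → T (Y p) → T (Z p)
    separators⇒⊆ {p} p∈V y with Y p | sep-at p∈V p∈V | Y⊆X p
    ... | true | h | Yp⇒Xp = proj₂ (to (T-∧ {X p}) (h (Yp⇒Xp tt)))

    -- Once `Z` contains an atom of `V` outside `Y`, the implications from that atom pull in every
    -- atom of `X` in `V`. Each of these implications is in force because its conclusion is true in
    -- `X`.
    separators⇒propagate : ∀ {p q} → p ∈ V → q ∈ V → ¬ T (Y p) → T (X p) → T (Z p) → T (X q) → T (Z q)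
    separators⇒propagate {p} {q} p∈V q∈V ¬y x z x′ with Y p | sep-at p∈V q∈V
    ... | true  | _ = contradiction tt ¬y
    ... | false | h = proj₂ (to (T-∧ {X q}) (to (T-⇒ {X p ∧ Z p})
      (proj₁ (to (T-∧ {not (X p ∧ Z p) ∨ (X q ∧ Z q)}) (h (from (T-⇒ {X p}) λ _ → x′)))) (from T-∧ (x , z))))

  strongly-equivalent⇒HT-entails : ∀ {F G} → StronglyEquivalent F G → F HT-entails G
  strongly-equivalent⇒HT-entails {F} {G} F≡G X Y Y⊆X h =
    HT-Model-resp G (agrees-sym X) (agrees-sym Y)
      (supported-case (restrict-supported V X) (restrict-mono V Y⊆X)
        (HT-Model-resp F (restrict-agrees V X ∘ ∈-++⁺ˡ) (restrict-agrees V Y ∘ ∈-++⁺ˡ) h))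
    where
    V = atomsᴾ F ++ atomsᴾ G
    agrees-sym : ∀ X → Agree (atomsᴾ G) (restrict V X) X
    agrees-sym X p∈G = sym (restrict-agrees V X (∈-++⁺ʳ (atomsᴾ F) p∈G))
    supported-case : ∀ {X Y} → Supported V X → Y ⊆ X → HT-Model F X Y → HT-Model G X Y
    supported-case {X} {Y} sX Y⊆X f = decidable-stable (HT-Model? G X Y) impossible
      where
      -- The negations are those of `G`, because `G ∪ H` is where `X` must receive positive
      -- probability; for `F ∪ H` instability alone gives probability 0.
      H = counterweight G (separators V Y)
      agree⇒model : ∀ {Z} → Agree V Z Y → HT-Model G X Z → HT-Model G X Y
      agree⇒model eq = HT-Model-resp G (λ _ → refl) (eq ∘ ∈-++⁺ʳ (atomsᴾ F))
      module _ (¬g : ¬ HT-Model G X Y) where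
        unstable : ¬ SM (F ∪ H) X
        -- Stability would give `X ⊆ Y`, so `X` and `Y` would coincide, and on the diagonal every
        -- program has its here-and-there model.
        unstable s = ¬g (agree⇒model
          (λ {p} _ → T-ext (X⊆Y p) (Y⊆X p)) (HT-Model-diagonal G X))
          where
          X⊆Y : X ⊆ Y
          X⊆Y = to (stable⇔ (F ∪ H)) s Y Y⊆X
            (All.++⁺ f (from (HT-Model-counterweight G (separators V Y)) (separators-hold V)))
        stable : SM (G ∪ H) X
        -- If `Z` misses an atom of `X`, propagation keeps it inside `Y` on `V`. It then agrees with
        -- `Y` there, and `(X , Y)` is not a model for `G`.
        stable = from (stable⇔ (G ∪ H)) λ Z Z⊆X h p x → decidable-stable (T? (Z p)) λ ¬z →
          let sep = to (HT-Model-counterweight G (separators V Y)) (All.++⁻ʳ G h)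
              Z⊆Y = λ {q} (q∈V : q ∈ V) z → decidable-stable (T? (Y q)) λ ¬y →
                ¬z (separators⇒propagate Y⊆X sep q∈V (sX p x) ¬y (Z⊆X q z) z x)
          in ¬g (agree⇒model (λ q∈V → T-ext (Z⊆Y q∈V) (separators⇒⊆ Y⊆X sep q∈V)) (All.++⁻ˡ G h))
        impossible : ⊥
        impossible = uniform-probability-≢0 (G ∪ H) (λ a Z → weight-balanced G (separators V Y) Z a) stable
          (to (F≡G H X 0#) (unstable-probability (F ∪ H) (proj₂ (enumerateSM (F ∪ H))) unstable))

  -- Condition (2) as mutual here-and-there entailment.

  HT-Model⇔Δ : ∀ P I (let X = I ∘ inj₁; Y = I ∘ inj₂) → Y ⊆ X →
    HT-Model P X Y ⇔ I ⊨ Δ⋀ (map choice (drop-weights P))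
  HT-Model⇔Δ P I Y⊆X = mk⇔
    (λ h → subst T (sym eval≡ht) (from (ht-⋀ Γ)
      (All.map⁺ (All.map⁺ (All.map (λ {(_ , R)} → from (ht-choice R)) h)))))
    (λ δ → All.map (λ {(_ , R)} → to (ht-choice R))
      (All.map⁻ (All.map⁻ (to (ht-⋀ Γ) (subst T eval≡ht δ)))))
    where
    Γ = map choice (drop-weights P)
    eval≡ht = eval-Δ I Y⊆X (⋀ Γ)

  -- The classical models of all `p′ → p` are the pairs `Y ⊆ X`, glued together by `[ X , Y ]′`; on
  -- such pairs `Δ` computes `ht`.
  Entails⇔ : ∀ F G →
    Entails Primed⇒Unprimed (Δ⋀ (map choice (drop-weights F)) ⇔ᶠ Δ⋀ (map choice (drop-weights G))) ⇔
    (F HT-entails G × G HT-entails F)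
  Entails⇔ F G = mk⇔ (λ ent → forwards ent , backwards ent) entails
    where
    δ : Program A → Formula (A ⊎ A)
    δ P = Δ⋀ (map choice (drop-weights P))
    module _ (ent : Entails Primed⇒Unprimed (δ F ⇔ᶠ δ G)) where
      both : ∀ X Y → Y ⊆ X → let I = [ X , Y ]′ in (I ⊨ δ F → I ⊨ δ G) × (I ⊨ δ G → I ⊨ δ F)
      both X Y Y⊆X =
        let f⇒g , g⇒f = to (T-∧ {eval I (δ F ⇒ᶠ δ G)}) (ent I λ { _ (p′⇒p p) → from (T-⇒ {Y p}) (Y⊆X p) })
        in to (T-⇒ {eval I (δ F)}) f⇒g , to (T-⇒ {eval I (δ G)}) g⇒f
        where I = [ X , Y ]′
      forwards : F HT-entails G
      forwards X Y Y⊆X h =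
        from (HT-Model⇔Δ G [ X , Y ]′ Y⊆X) (proj₁ (both X Y Y⊆X) (to (HT-Model⇔Δ F [ X , Y ]′ Y⊆X) h))
      backwards : G HT-entails F
      backwards X Y Y⊆X h =
        from (HT-Model⇔Δ F [ X , Y ]′ Y⊆X) (proj₂ (both X Y Y⊆X) (to (HT-Model⇔Δ G [ X , Y ]′ Y⊆X) h))
    entails : F HT-entails G × G HT-entails F → Entails Primed⇒Unprimed (δ F ⇔ᶠ δ G)
    entails (F⊑G , G⊑F) I pr = from (T-∧ {eval I (δ F ⇒ᶠ δ G)})
      ( from (T-⇒ {eval I (δ F)}) (to (HT-Model⇔Δ G I Y⊆X) ∘ F⊑G _ _ Y⊆X ∘ from (HT-Model⇔Δ F I Y⊆X))
      , from (T-⇒ {eval I (δ G)}) (to (HT-Model⇔Δ F I Y⊆X) ∘ G⊑F _ _ Y⊆X ∘ from (HT-Model⇔Δ G I Y⊆X)))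
      where
      Y⊆X : (I ∘ inj₂) ⊆ (I ∘ inj₁)
      Y⊆X p = to (T-⇒ {I (inj₂ p)}) (pr _ (p′⇒p p))

  -- Constant differences and the constants of the w-expression.

  SameDifferences-sym : ∀ F G → SameDifferences F G → SameDifferences G F
  SameDifferences-sym F G same X Y =
    trans (+-comm _ _) (trans (proj₁ (same Y X)) (+-comm _ _)) ,
    trans (ℕ.+-comm (hard-unsat G X) _) (trans (proj₂ (same Y X)) (ℕ.+-comm (hard-unsat F X) _))

  DifferBy : Carrier → ℤ → Program A → Program A → Set
  DifferBy c₁ c₂ F G = ∀ X →
    soft-unsat F X ≡ c₁ + soft-unsat G X × + hard-unsat F X ≡ c₂ +ᶻ + hard-unsat G X

  DifferBy⇒SameDifferences : ∀ F G c₁ c₂ → DifferBy c₁ c₂ F G → SameDifferences F G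
  DifferBy⇒SameDifferences F G c₁ c₂ eqs X Y =
    ℝ-Exchange.difference⇒exchange c₁ (proj₁ (eqs X)) (proj₁ (eqs Y)) ,
    ℤ.+-injective (ℤ-Exchange.difference⇒exchange c₂ (proj₂ (eqs X)) (proj₂ (eqs Y)))

  SameDifferences⇒DifferBy : ∀ F G → SameDifferences F G → ∃₂ λ c₁ c₂ → DifferBy c₁ c₂ F G
  SameDifferences⇒DifferBy F G same = c₁ , c₂ , λ X →
    ℝ-Exchange.exchange⇒difference (proj₁ (same X ∅)) ,
    ℤ-Exchange.exchange⇒difference {+ hard-unsat G ∅} {+ hard-unsat F X} {+ hard-unsat F ∅} {+ hard-unsat G X}
      (cong +_ (proj₂ (same X ∅)))
    where
    ∅ : Interpretation A
    ∅ _ = false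
    -- The constants are the differences at the reference interpretation `∅`, to which every `X` is
    -- compared.
    c₁ = soft-unsat F ∅ - soft-unsat G ∅
    c₂ = + hard-unsat F ∅ -ᶻ + hard-unsat G ∅

mainTheorem9 : (ℝ : RealNumbers) (A : Set) → DecidableEquality A →
    let open RealNumbers ℝ
        open LPMLN ℝ
    in (F G : Program A) →
       StronglyEquivalent F G ⇔
       (∃₂ λ (c₁ : Carrier) (c₂ : ℤ) →
         ((X : Interpretation A) →
           (∑ (soft-weights (unsatisfied F X)) ≡ c₁ + ∑ (soft-weights (unsatisfied G X))) ×
           (+ hard-count (unsatisfied F X) ≡ c₂ +ᶻ (+ hard-count (unsatisfied G X)))) ×
         Entails Primed⇒Unprimed
           (Δ⋀ (map choice (drop-weights F)) ⇔ᶠ Δ⋀ (map choice (drop-weights G))))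
mainTheorem9 ℝ A _≟_ F G = mk⇔
  (λ F≡G →
    let c₁ , c₂ , eqs = SameDifferences⇒DifferBy F G (same-differences F≡G)
    in c₁ , c₂ , eqs , from (Entails⇔ F G)
         ( strongly-equivalent⇒HT-entails F≡G
         , strongly-equivalent⇒HT-entails (λ H X r → mk⇔ (from (F≡G H X r)) (to (F≡G H X r)))))
  (λ (c₁ , c₂ , eqs , ent) H X r →
    let same = DifferBy⇒SameDifferences F G c₁ c₂ eqs
        F⊑G , G⊑F = to (Entails⇔ F G) ent
    in mk⇔ (transfer-probability F G same F⊑G G⊑F H)
           (transfer-probability G F (SameDifferences-sym F G same) G⊑F F⊑G H))
  where open Characterisation ℝ _≟_
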